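{- Let $D$ be a digraph. Then $\mathrm{dbw}(D)-1\le \mathrm{dtw}(D)\le 9\,\mathrm{dbw}(D)+1$, where $\mathrm{dbw}(D)$ is the directed branchwidth and $\mathrm{dtw}(D)$ the directed treewidth of $D$.
   Context: All digraphs $D=(V(D),E(D))$ are finite, nonempty and simple: no loops and no parallel edges, but both $(u,v)$ and $(v,u)$ may be present (a digon). A directed walk may repeat vertices. A directed cycle has pairwise distinct vertices; a digon is a directed cycle of length $2$. Directed treewidth. An arborescence $T$ is an orientation of an undirected tree with a unique vertex $r$ (the root) from which all vertices are reachable; for $t\in V(T)$, $T_t$ is the subgraph of $T$ induced by the vertices reachable from $t$. A directed tree decomposition of $D$ is a triple $(T,\beta,\gamma)$ where $T$ is an arborescence, $\beta:V(T)\to 2^{V(D)}$ is such that the sets $\beta(t)$ form a partition of $V(D)$ into nonempty sets, and $\gamma:E(T)\to 2^{V(D)}$ is such that for every $(d,t)\in E(T)$ the set $\gamma((d,t))$ meets every directed walk in $D$ that starts and ends in $\beta(T_t):=\bigcup_{t'\in V(T_t)}\beta(t')$ and contains a vertex not in $\beta(T_t)$. Put $\Gamma(t):=\beta(t)\cup\bigcup_{e\text{ incident with }t}\gamma(e)$. The width is $\max_{t\in V(T)}|\Gamma(t)|-1$, and $\mathrm{dtw}(D)$ is the minimum width of a directed tree decomposition of $D$. Directed branchwidth. A directed branch decomposition of $D$ is a pair $(T,\delta)$ where $T$ is an undirected tree of maximum degree at most three and $\delta$ is a bijection from the set of leaves of $T$ to $V(D)$ (if $|V(D)|=1$, $T$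 is a single vertex, regarded as a leaf, and the width is $0$). For an edge $t_1t_2\in E(T)$ let $T_{t_i}$ be the component of $T-t_1t_2$ containing $t_i$, and $\delta(T_{t_i})$ the set of images of the leaves of $T$ lying in $T_{t_i}$. The thickness of $t_1t_2$ is the minimum size of a set $S\subseteq V(D)$ that meets every directed cycle of $D$ having a vertex in $\delta(T_{t_1})$ and a vertex in $V(D)\setminus\delta(T_{t_1})$. The width of $(T,\delta)$ is the maximum thickness of an edge of $T$, and $\mathrm{dbw}(D)$ is the minimum width of a directed branch decomposition of $D$. -}

module Defs where

open import Data.Bool.Base using (Bool; true; false; T)
open import Data.Fin.Base using (Fin)
open import Data.Fin.Subset using (Subset; _∈_; Nonempty; ∣_∣; _∪_; ⋃; ⊥)
open import Data.List.Base using (List; []; _∷_; length; map; allFin)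
open import Data.List.Extrema.Nat using (max)
open import Data.List.Relation.Unary.Any using (Any)
open import Data.List.Relation.Unary.Unique.Propositional using (Unique)
open import Data.Nat.Base using (ℕ; _≤_; _∸_; NonZero)
open import Data.Product using (Σ; ∃; ∃!; ∃-syntax; _×_; proj₁)
open import Data.Sum.Base using (_⊎_)
open import Data.Unit.Base using (tt)
open import Data.Vec.Base using (tabulate)
open import Function.Bundles using (_⤖_; Bijection)
open import Level using (0ℓ)
open import Relation.Binary.Construct.Closure.ReflexiveTransitive using (Star; ε; _◅_)
open import Relation.Binary.Construct.Closure.Symmetric using (SymClosure)
open import Relation.Binary.Core using (Rel)
open import Relation.Binary.Definitions using (Symmetric; Asymmetric)
open import Relation.Binary.PropositionalEquality.Core using (_≡_)
open import Relation.Nullary.Negation.Core using (¬_)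

IsMin : (ℕ → Set) → ℕ → Set
IsMin P m = P m × (∀ {k} → P k → m ≤ k)

IsMax : (ℕ → Set) → ℕ → Set
IsMax P m = P m × (∀ {k} → P k → k ≤ m)

-- A walk from x to y is an element of Star R x y; this lists its vertices
-- in order, both ends included.
vertices : {V : Set} {R : Rel V 0ℓ} {x y : V} → Star R x y → List V
vertices {x = x} ε       = x ∷ []
vertices {x = x} (_ ◅ p) = x ∷ vertices p

record Digraph : Set where
  field
    order        : ℕ
    {{nonEmpty}} : NonZero order
    edge         : Fin order → Fin order → Bool

  V : Set
  V = Fin order

  Edge : Rel V 0ℓ
  Edge u v = T (edge u v)

  field
    loopless : ∀ v → ¬ Edge v v

  Walk : Rel V 0ℓ
  Walk = Star Edge

  -- A path together with an edge from its end back to its start.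
  -- By looplessness the length is at least two, and digons are included.
  record Cycle : Set where
    field
      {start end} : V
      path        : Walk start end
      closing     : Edge end start
      distinct    : Unique (vertices path)

    cycleVertices : List V
    cycleVertices = vertices path

  outDegree : V → ℕ
  outDegree v = ∣ tabulate (edge v) ∣

open Digraph using (V; Edge; Walk; Cycle; order; edge; outDegree)
open Cycle using (cycleVertices)

_meets_ : ∀ {n} → Subset n → List (Fin n) → Set
S meets xs = Any (_∈ S) xs

-- Here _~_ is the (symmetric) adjacency relation of an undirected graph.
-- The bound 3 ≤ length excludes traversing one edge back and forth.
record IsTree {A : Set} (_~_ : Rel A 0ℓ) : Set where
  field
    connected : ∀ u v → Star _~_ u v
    acyclic   : ∀ {u v} (p : Star _~_ u v) → v ~ u →
                Unique (vertices p) → ¬ (3 ≤ length (vertices p))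

record IsArborescence (A : Digraph) : Set where
  field
    oriented   : Asymmetric (Edge A)
    underlying : IsTree (SymClosure (Edge A))
    root       : ∃! _≡_ λ r → ∀ t → Walk A r t

-- The value of a partial function on a decidable domain, with ∅ outside it.
orEmpty : ∀ {n} (b : Bool) → (T b → Subset n) → Subset n
orEmpty true  f = f tt
orEmpty false f = ⊥

record TreeDecomposition (D : Digraph) : Set where
  field
    tree           : Digraph
    isArborescence : IsArborescence tree
    β              : V tree → Subset (order D)
    β-nonempty     : ∀ t → Nonempty (β t)
    β-partition    : ∀ v → ∃! _≡_ λ t → v ∈ β t
    γ              : ∀ d t → Edge tree d t → Subset (order D)

  -- v ∈ β(T_t)
  Below : V tree → V D → Set
  Below t v = ∃[ t′ ] Walk tree t t′ × v ∈ β t′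

  field
    γ-guards : ∀ {d t} (e : Edge tree d t) {x y} (p : Walk D x y) →
               Below t x → Below t y → Any (λ v → ¬ Below t v) (vertices p) →
               γ d t e meets vertices p

  Γ : V tree → Subset (order D)
  Γ t = β t ∪ ⋃ (map (λ s → orEmpty (edge tree s t) (γ s t) ∪
                            orEmpty (edge tree t s) (γ t s))
                     (allFin (order tree)))

  width : ℕ
  width = max 0 (map (λ t → ∣ Γ t ∣) (allFin (order tree))) ∸ 1

IsDirectedTreewidth : Digraph → ℕ → Set
IsDirectedTreewidth D =
  IsMin λ w → Σ (TreeDecomposition D) λ 𝒯 → TreeDecomposition.width 𝒯 ≡ w

-- For a symmetric digraph, outDegree is the degree of the undirected graph.
-- A tree has a vertex of degree 0 only if it is a single vertex, and that
-- vertex counts as a leaf.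
Leaf : Digraph → Set
Leaf G = Σ (V G) λ t → outDegree G t ≤ 1

Without : (G : Digraph) → V G → V G → Rel (V G) 0ℓ
Without G a b u v = Edge G u v × ¬ ((u ≡ a × v ≡ b) ⊎ (u ≡ b × v ≡ a))

record BranchDecomposition (D : Digraph) : Set where
  field
    tree       : Digraph
    undirected : Symmetric (Edge tree)
    isTree     : IsTree (Edge tree)
    subcubic   : ∀ t → outDegree tree t ≤ 3
    δ          : Leaf tree ⤖ V D

  -- v ∈ δ(T_{t₁}), for the edge t₁t₂
  Side : V tree → V tree → V D → Set
  Side t₁ t₂ v =
    Σ (Leaf tree) λ ℓ → Star (Without tree t₁ t₂) t₁ (proj₁ ℓ) × Bijection.to δ ℓ ≡ v

  Separates : V tree → V tree → Subset (order D) → Set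
  Separates t₁ t₂ S = (C : Cycle D) →
    Any (Side t₁ t₂) (cycleVertices C) →
    Any (λ v → ¬ Side t₁ t₂ v) (cycleVertices C) →
    S meets cycleVertices C

  Thickness : V tree → V tree → ℕ → Set
  Thickness t₁ t₂ = IsMin λ k → ∃[ S ] Separates t₁ t₂ S × ∣ S ∣ ≡ k

  -- Including 0 affects only the edgeless tree, whose width is 0.
  Width : ℕ → Set
  Width = IsMax λ k → k ≡ 0 ⊎
    (∃[ t₁ ] ∃[ t₂ ] Edge tree t₁ t₂ × Thickness t₁ t₂ k)

IsDirectedBranchwidth : Digraph → ℕ → Set
IsDirectedBranchwidth D =
  IsMin λ w → Σ (BranchDecomposition D) λ ℬ → BranchDecomposition.Width ℬ w

{-# OPTIONS --safe #-}
-- Both goals are decidable inequalities, so reachability, separation and the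
-- existence of minima may be decided classically under a double negation.
--
-- dtw ≤ 9 dbw + 1: let dbw = k. For every set Z of at most 6k + 1 vertices some
-- node of the branch decomposition has at most 3k elements of Z beyond each of
-- its edges. The union X of the at most three separators of these edges has at
-- most 3k elements, and each strong component C of D − X that contains a vertex
-- outside Z meets Z in at most 3k elements, so X ∪ (Z ∩ C), with one
-- further vertex put into X to guarantee progress, again has at most 6k + 1
-- elements. Iterating on the components gives a decomposition with singleton
-- bags and guards inside Z ∪ X, where ∣Z ∪ X∣ ≤ 9k + 2.
--
-- dbw ∸ 1 ≤ dtw: replace every node t of the arborescence by a binary tree
-- over the elements of β(t) and the subtrees of the children of t. A cycle that
-- avoids Γ(t) and leaves a union of such parts enters and leaves the subtree of
-- a child, hence meets the guard of that child, which is contained in Γ(t).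
module Submission where

open import Defs
open import Data.Bool.Base using (Bool; true; false; T)
open import Data.Bool.Properties using (T?)
open import Data.Empty using (⊥; ⊥-elim)
open import Data.Fin.Base using (Fin; zero; suc; toℕ; punchOut; splitAt; join)
open import Data.Fin.Properties using (_≟_; any?; suc-injective; toℕ-injective; toℕ<n; punchOut-injective; splitAt-join; join-splitAt)
open import Data.Fin.Subset using (Subset; inside; outside; _∈_; _∉_; _⊆_; _⊂_; Nonempty; ∣_∣; _∪_; _∩_; _-_; ⁅_⁆; ⋃; ⊤)
  renaming (⊥ to ∅)
open import Data.Fin.Subset.Properties hiding (_∈?_)
open import Data.Fin.Subset.Properties using () renaming (_∈?_ to _∈ₛ?_)
open import Data.List.Base using (List; []; _∷_; length; map; allFin)
open import Data.List.Extrema.Nat using (max≤v⁺; xs≤max)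
open import Data.List.Membership.Propositional using (find; lose) renaming (_∈_ to _∈ˡ_; _∉_ to _∉ˡ_)
open import Data.List.Membership.Propositional.Properties using (∈-allFin; ∈-map⁺; ∈-map⁻)
open import Data.List.Relation.Binary.Subset.Propositional using () renaming (_⊆_ to _⊆ˡ_)
open import Data.List.Relation.Unary.All as All using (All; []; _∷_)
open import Data.List.Relation.Unary.All.Properties as AllP using ()
open import Data.List.Relation.Unary.AllPairs using ([]; _∷_)
open import Data.List.Relation.Unary.Any as Any using (Any; here; there)
open import Data.List.Relation.Unary.Unique.Propositional using (Unique)
open import Data.Nat.Base using (ℕ; zero; suc; _+_; _*_; _∸_; _≤_; _<_; z≤n; s≤s; NonZero)
open import Data.Nat.Properties as ℕₚ using (_≤?_; _<?_; ≤-refl; ≤-trans; ≤-reflexive; <-irrefl; ≤-<-trans; <-≤-trans; ≮⇒≥; n≤1+n; +-mono-≤; m≤m+n)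
open import Data.Nat.Tactic.RingSolver using (solve-∀)
open import Data.Product using (Σ; ∃; ∃-syntax; _×_; _,_; proj₁; proj₂)
open import Data.Sum.Base using (_⊎_; inj₁; inj₂; [_,_]′; swap)
open import Data.Unit.Base using (tt)
open import Data.Vec.Base using (tabulate; []; _∷_; here; there)
open import Data.Vec.Properties using ([]=⇒lookup; lookup⇒[]=; lookup∘tabulate)
open import Function.Base using (_∘_; id)
open import Function.Bundles using (Bijection; mk⤖)
open import Level using (0ℓ)
open import Relation.Binary.Construct.Closure.ReflexiveTransitive using (Star; ε; _◅_; _◅◅_; reverse)
import Relation.Binary.Construct.Closure.ReflexiveTransitive as Star
open import Relation.Binary.Construct.Closure.Symmetric using (SymClosure; fwd; bwd)
open import Relation.Binary.Core using (Rel)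
open import Relation.Binary.Definitions using (Symmetric; tri<; tri≈; tri>)
open import Relation.Binary.PropositionalEquality using (_≡_; _≢_; refl; sym; trans; cong; cong₂; subst; subst₂; ≢-sym)
open import Relation.Nullary using (¬_; Dec; yes; no; does; contradiction)
open import Relation.Nullary.Decidable using (¬?; _×-dec_; _⊎-dec_; decidable-stable; ¬¬-excluded-middle)
open import Relation.Nullary.Negation using (¬¬-map)

open Digraph using (V; Edge; Walk; Cycle; order; edge; loopless)
open Cycle using (cycleVertices)

private
  variable
    m n : ℕ

-- Double-negation shift and extrema over finite domains.

fin-¬¬ : {P : Fin n → Set} → (∀ i → ¬ ¬ P i) → ¬ ¬ (∀ i → P i)
fin-¬¬ {zero}  h k = k λ ()
fin-¬¬ {suc n} h k =
  h zero λ p₀ → fin-¬¬ (h ∘ suc) λ p → k λ { zero → p₀ ; (suc i) → p i }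

subset-¬¬ : {P : Subset n → Set} → (∀ S → ¬ ¬ P S) → ¬ ¬ (∀ S → P S)
subset-¬¬ {zero}  h k = h [] λ p → k λ { [] → p }
subset-¬¬ {suc n} h k =
  subset-¬¬ (h ∘ (inside ∷_)) λ p → subset-¬¬ (h ∘ (outside ∷_)) λ q →
  k λ { (inside ∷ S) → p S ; (outside ∷ S) → q S }

least-¬¬ : {P : ℕ → Set} (k : ℕ) → P k → ¬ ¬ ∃ (IsMin P)
least-¬¬ {P} zero    p h = h (0 , p , λ _ → z≤n)
least-¬¬ {P} (suc k) p h = ¬¬-excluded-middle {A = P 0} λ where
  (yes p₀) → h (0 , p₀ , λ _ → z≤n)
  (no ¬p₀) → least-¬¬ {P ∘ suc} k p λ (m , pm , least) →
    h (suc m , pm , λ { {zero} q → contradiction q ¬p₀ ; {suc j} q → s≤s (least q) })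

greatest-¬¬ : {P : ℕ → Set} (b : ℕ) → ∃ P → (∀ {k} → P k → k ≤ b) → ¬ ¬ ∃ (IsMax P)
greatest-¬¬ {P} b (k₀ , p₀) bound h = ¬¬-excluded-middle {A = P b} λ where
    (yes pb) → h (b , pb , bound)
    (no ¬pb) → below b bound ¬pb
  where
  below : ∀ b → (∀ {k} → P k → k ≤ b) → ¬ P b → ⊥
  below zero    bound ¬pb = ¬pb (subst P (ℕₚ.n≤0⇒n≡0 (bound p₀)) p₀)
  below (suc b) bound ¬pb =
    greatest-¬¬ b (k₀ , p₀)
      (λ {k} p → ℕₚ.≤-pred (ℕₚ.≤∧≢⇒< (bound p) λ { refl → ¬pb p })) h

-- Finite sets

some : ∀ n {{_ : NonZero n}} → Fin n
some (suc _) = zero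

subsetOf : {P : Fin n → Set} → (∀ i → Dec (P i)) → Subset n
subsetOf P? = tabulate (does ∘ P?)

T⇒≡ : ∀ {b} → T b → b ≡ true
T⇒≡ {true} _ = refl

≡⇒T : ∀ {b} → b ≡ true → T b
≡⇒T refl = tt

∈-tabulate⁺ : (f : Fin n → Bool) {i : Fin n} → T (f i) → i ∈ tabulate f
∈-tabulate⁺ f {i} t = lookup⇒[]= i _ (trans (lookup∘tabulate f i) (T⇒≡ t))

∈-tabulate⁻ : (f : Fin n → Bool) {i : Fin n} → i ∈ tabulate f → T (f i)
∈-tabulate⁻ f {i} i∈ = ≡⇒T (trans (sym (lookup∘tabulate f i)) ([]=⇒lookup i∈))

T-does : {P : Set} (d : Dec P) → T (does d) → P
T-does (yes p) _ = p

does-T : {P : Set} (d : Dec P) → P → T (does d)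
does-T (yes _) _ = tt
does-T (no ¬p) p = ¬p p

module _ {P : Fin n → Set} (P? : ∀ i → Dec (P i)) where

  ∈-subsetOf⁺ : ∀ {i} → P i → i ∈ subsetOf P?
  ∈-subsetOf⁺ {i} p = ∈-tabulate⁺ (does ∘ P?) (does-T (P? i) p)

  ∈-subsetOf⁻ : ∀ {i} → i ∈ subsetOf P? → P i
  ∈-subsetOf⁻ {i} i∈ = T-does (P? i) (∈-tabulate⁻ (does ∘ P?) i∈)

∈-minus⁻ : (S : Subset n) {x y : Fin n} → x ∈ S - y → x ∈ S × x ≢ y
∈-minus⁻ S {x} {y} x∈ = p─q⊆p S ⁅ y ⁆ x∈ , λ { refl → y∉ S x x∈ }
  where
  y∉ : ∀ {n} (S : Subset n) y → y ∉ S - y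
  y∉ (_ ∷ S) zero    ()
  y∉ (_ ∷ S) (suc y) (there i) = y∉ S y i

∣p∪q∣≤∣p∣+∣q∣ : (p q : Subset n) → ∣ p ∪ q ∣ ≤ ∣ p ∣ + ∣ q ∣
∣p∪q∣≤∣p∣+∣q∣ []            []            = z≤n
∣p∪q∣≤∣p∣+∣q∣ (inside ∷ p)  (outside ∷ q) = s≤s (∣p∪q∣≤∣p∣+∣q∣ p q)
∣p∪q∣≤∣p∣+∣q∣ (inside ∷ p)  (inside ∷ q)  =
  s≤s (≤-trans (∣p∪q∣≤∣p∣+∣q∣ p q) (ℕₚ.+-monoʳ-≤ ∣ p ∣ (n≤1+n _)))
∣p∪q∣≤∣p∣+∣q∣ (outside ∷ p) (inside ∷ q)  =
  ≤-trans (s≤s (∣p∪q∣≤∣p∣+∣q∣ p q)) (≤-reflexive (sym (ℕₚ.+-suc ∣ p ∣ ∣ q ∣)))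
∣p∪q∣≤∣p∣+∣q∣ (outside ∷ p) (outside ∷ q) = ∣p∪q∣≤∣p∣+∣q∣ p q

disjoint⇒∣p∣+∣q∣≤∣r∣ : (p q r : Subset n) → p ⊆ r → q ⊆ r →
  (∀ {x} → x ∈ p → x ∉ q) → ∣ p ∣ + ∣ q ∣ ≤ ∣ r ∣
disjoint⇒∣p∣+∣q∣≤∣r∣ [] [] [] _ _ _ = z≤n
disjoint⇒∣p∣+∣q∣≤∣r∣ (a ∷ p) (b ∷ q) (c ∷ r) p⊆r q⊆r dis with
  disjoint⇒∣p∣+∣q∣≤∣r∣ p q r (drop-∷-⊆ p⊆r) (drop-∷-⊆ q⊆r) (λ i j → dis (there i) (there j))
disjoint⇒∣p∣+∣q∣≤∣r∣ (inside ∷ p) (inside ∷ q) (c ∷ r) p⊆r q⊆r dis | ih =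
  contradiction here (dis here)
disjoint⇒∣p∣+∣q∣≤∣r∣ (inside ∷ p) (outside ∷ q) (c ∷ r) p⊆r q⊆r dis | ih with p⊆r here
... | here = s≤s ih
disjoint⇒∣p∣+∣q∣≤∣r∣ (outside ∷ p) (inside ∷ q) (c ∷ r) p⊆r q⊆r dis | ih with q⊆r here
... | here = ≤-trans (≤-reflexive (ℕₚ.+-suc ∣ p ∣ ∣ q ∣)) (s≤s ih)
disjoint⇒∣p∣+∣q∣≤∣r∣ (outside ∷ p) (outside ∷ q) (c ∷ r) p⊆r q⊆r dis | ih =
  ≤-trans ih (∣p∣≤∣x∷p∣ c r)

-- Induction on the subset: the value taken by its first element is removed from the range by
-- `punchOut`, so that the remaining elements inject into a range smaller by one.
card-≤ : ∀ {n k} (S : Subset n) (f : ∀ i → i ∈ S → Fin k) →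
  (∀ {i j} (i∈ : i ∈ S) (j∈ : j ∈ S) → f i i∈ ≡ f j j∈ → i ≡ j) → ∣ S ∣ ≤ k
card-≤ [] f inj = z≤n
card-≤ (outside ∷ S) f inj =
  card-≤ S (λ i → f (suc i) ∘ there) λ i∈ j∈ eq → suc-injective (inj (there i∈) (there j∈) eq)
card-≤ {k = zero}  (inside ∷ S) f inj with () ← f zero here
card-≤ {k = suc k} (inside ∷ S) f inj =
  s≤s (card-≤ S (λ i i∈ → punchOut (new i∈))
    λ i∈ j∈ eq → suc-injective (inj (there i∈) (there j∈) (punchOut-injective (new i∈) (new j∈) eq)))
  where
  new : ∀ {i} (i∈ : i ∈ S) → f zero here ≢ f (suc i) (there i∈)
  new i∈ eq with () ← inj here (there i∈) eq

subsingleton⇒∣S∣≤1 : (S : Subset n) → (∀ {x y} → x ∈ S → y ∈ S → x ≡ y) → ∣ S ∣ ≤ 1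
subsingleton⇒∣S∣≤1 S unique = card-≤ S (λ _ _ → zero) λ i∈ j∈ _ → unique i∈ j∈

two-elements : (S : Subset n) {x y : Fin n} → x ∈ S → y ∈ S → x ≢ y → ¬ ∣ S ∣ ≤ 1
two-elements S {x} {y} x∈ y∈ x≢y ∣S∣≤1 = <-irrefl refl (≤-trans
  (≤-trans (≤-reflexive (cong₂ _+_ (sym (∣⁅x⁆∣≡1 x)) (sym (∣⁅x⁆∣≡1 y))))
    (disjoint⇒∣p∣+∣q∣≤∣r∣ ⁅ x ⁆ ⁅ y ⁆ S (sub x∈) (sub y∈)
      λ i j → x≢y (trans (sym (x∈⁅y⁆⇒x≡y x i)) (x∈⁅y⁆⇒x≡y y j))))
  ∣S∣≤1)
  where
  sub : ∀ {z} → z ∈ S → ⁅ z ⁆ ⊆ S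
  sub {z} z∈ w∈ = subst (_∈ S) (sym (x∈⁅y⁆⇒x≡y z w∈)) z∈

-- The index set is a `Subset`, so that the size of the union is bounded by the number of its
-- members, such as the at most three neighbours of a node.
⋃[_] : Subset n → (Fin n → Subset m) → Subset m
⋃[ [] ]          f = ∅
⋃[ inside ∷ S ]  f = f zero ∪ ⋃[ S ] (f ∘ suc)
⋃[ outside ∷ S ] f = ⋃[ S ] (f ∘ suc)

∈-⋃[]⁺ : (S : Subset n) (f : Fin n → Subset m) {i : Fin n} {x : Fin m} →
  i ∈ S → x ∈ f i → x ∈ ⋃[ S ] f
∈-⋃[]⁺ (_ ∷ S)       f here       x∈ = p⊆p∪q _ x∈
∈-⋃[]⁺ (inside ∷ S)  f (there i∈) x∈ = q⊆p∪q (f zero) _ (∈-⋃[]⁺ S (f ∘ suc) i∈ x∈)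
∈-⋃[]⁺ (outside ∷ S) f (there i∈) x∈ = ∈-⋃[]⁺ S (f ∘ suc) i∈ x∈

∣⋃[]∣≤ : (S : Subset n) (f : Fin n → Subset m) {k : ℕ} →
  (∀ {i} → i ∈ S → ∣ f i ∣ ≤ k) → ∣ ⋃[ S ] f ∣ ≤ ∣ S ∣ * k
∣⋃[]∣≤ {m = m} [] f bound = ≤-reflexive (∣⊥∣≡0 m)
∣⋃[]∣≤ (inside ∷ S)  f bound = ≤-trans (∣p∪q∣≤∣p∣+∣q∣ (f zero) (⋃[ S ] (f ∘ suc)))
  (+-mono-≤ (bound here) (∣⋃[]∣≤ S (f ∘ suc) (bound ∘ there)))
∣⋃[]∣≤ (outside ∷ S) f bound = ∣⋃[]∣≤ S (f ∘ suc) (bound ∘ there)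

∈-⋃⁺ : {xs : List (Subset n)} {S : Subset n} {x : Fin n} → S ∈ˡ xs → x ∈ S → x ∈ ⋃ xs
∈-⋃⁺ (here refl) x∈ = p⊆p∪q _ x∈
∈-⋃⁺ (there S∈)  x∈ = q⊆p∪q _ _ (∈-⋃⁺ S∈ x∈)

∈-⋃⁻ : (xs : List (Subset n)) {x : Fin n} → x ∈ ⋃ xs → ∃[ S ] S ∈ˡ xs × x ∈ S
∈-⋃⁻ []       x∈ = contradiction x∈ ∉⊥
∈-⋃⁻ (S ∷ xs) x∈ with x∈p∪q⁻ S _ x∈
... | inj₁ x∈S = S , here refl , x∈S
... | inj₂ x∈⋃ = let S′ , S′∈ , x∈S′ = ∈-⋃⁻ xs x∈⋃ in S′ , there S′∈ , x∈S′

-- Walks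

infix 4 _∈ˡ?_
_∈ˡ?_ : (x : Fin n) (xs : List (Fin n)) → Dec (x ∈ˡ xs)
x ∈ˡ? xs = Any.any? (x ≟_) xs

module _ {A : Set} {R : Rel A 0ℓ} where

  start∈ : ∀ {x y} (p : Star R x y) → x ∈ˡ vertices p
  start∈ ε       = here refl
  start∈ (_ ◅ _) = here refl

  positive : ∀ {x y} (p : Star R x y) → 1 ≤ length (vertices p)
  positive ε       = s≤s z≤n
  positive (_ ◅ _) = s≤s z≤n

  end∈ : ∀ {x y} (p : Star R x y) → y ∈ˡ vertices p
  end∈ ε       = here refl
  end∈ (_ ◅ p) = there (end∈ p)

  ◅◅-vertices⁺ˡ : ∀ {x y z} (p : Star R x y) (q : Star R y z) → vertices p ⊆ˡ vertices (p ◅◅ q)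
  ◅◅-vertices⁺ˡ ε       q (here refl) = start∈ q
  ◅◅-vertices⁺ˡ (_ ◅ p) q (here refl) = here refl
  ◅◅-vertices⁺ˡ (_ ◅ p) q (there w∈)  = there (◅◅-vertices⁺ˡ p q w∈)

  ◅◅-vertices⁺ʳ : ∀ {x y z} (p : Star R x y) (q : Star R y z) → vertices q ⊆ˡ vertices (p ◅◅ q)
  ◅◅-vertices⁺ʳ ε       q w∈ = w∈
  ◅◅-vertices⁺ʳ (_ ◅ p) q w∈ = there (◅◅-vertices⁺ʳ p q w∈)

  ◅◅-vertices⁻ : ∀ {x y z w} (p : Star R x y) (q : Star R y z) →
    w ∈ˡ vertices (p ◅◅ q) → w ∈ˡ vertices p ⊎ w ∈ˡ vertices q
  ◅◅-vertices⁻ ε       q w∈          = inj₂ w∈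
  ◅◅-vertices⁻ (_ ◅ p) q (here refl) = inj₁ (here refl)
  ◅◅-vertices⁻ (_ ◅ p) q (there w∈) with ◅◅-vertices⁻ p q w∈
  ... | inj₁ w∈p = inj₁ (there w∈p)
  ... | inj₂ w∈q = inj₂ w∈q

  prefix : ∀ {x y z} (p : Star R x y) → z ∈ˡ vertices p →
    Σ (Star R x z) λ q → vertices q ⊆ˡ vertices p × (Unique (vertices p) → Unique (vertices q))
  prefix ε       (here refl) = ε , id , id
  prefix (e ◅ p) (here refl) = ε , (λ { (here refl) → here refl }) , λ _ → [] ∷ []
  prefix (e ◅ p) (there z∈)  =
    let q , q⊆p , u = prefix p z∈ in
    e ◅ q , (λ { (here refl) → here refl ; (there w∈) → there (q⊆p w∈) }) ,
    λ { (new ∷ up) → All.tabulate (All.lookup new ∘ q⊆p) ∷ u up }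

  suffix : ∀ {x y z} (p : Star R x y) → z ∈ˡ vertices p →
    Σ (Star R z y) λ q → vertices q ⊆ˡ vertices p × (Unique (vertices p) → Unique (vertices q))
  suffix ε       (here refl) = ε , id , id
  suffix (e ◅ p) (here refl) = e ◅ p , id , id
  suffix (e ◅ p) (there z∈)  =
    let q , q⊆p , u = suffix p z∈ in q , there ∘ q⊆p , λ { (_ ∷ up) → u up }

-- Loop erasure from the end backwards: if the new first vertex recurs in the simplified tail, the
-- suffix from that recurrence on replaces the whole walk.
simplify : {R : Rel (Fin n) 0ℓ} {x y : Fin n} (p : Star R x y) →
  Σ (Star R x y) λ q → Unique (vertices q) × vertices q ⊆ˡ vertices p
simplify ε = ε , [] ∷ [] , id
simplify {x = x} (e ◅ p) with simplify p
... | q , uq , q⊆p with x ∈ˡ? vertices q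
...   | yes x∈ = let q′ , q′⊆q , u = suffix q x∈ in q′ , u uq , there ∘ q⊆p ∘ q′⊆q
...   | no x∉  =
  e ◅ q , All.tabulate (λ { w∈ refl → x∉ w∈ }) ∷ uq ,
  λ { (here refl) → here refl ; (there w∈) → there (q⊆p w∈) }

map-vertices : {A : Set} {R S : Rel A 0ℓ} (f : ∀ {u v} → R u v → S u v) {x y : A} (p : Star R x y) →
  vertices (Star.map f p) ≡ vertices p
map-vertices f ε       = refl
map-vertices f (_ ◅ p) = cong (_ ∷_) (map-vertices f p)

crossing : {R : Rel (Fin n) 0ℓ} {P : Fin n → Set} → (∀ i → Dec (P i)) →
  ∀ {x y} → Star R x y → P x → ¬ P y →
  ∃[ a ] ∃[ b ] Star R x a × R a b × Star R b y × P a × ¬ P b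
crossing P? ε       px ¬py = contradiction px ¬py
crossing P? {x} (_◅_ {j = j} e p) px ¬py with P? j
... | no ¬pj = x , j , ε , e , p , px , ¬pj
... | yes pj =
  let a , b , q , e′ , r , pa , ¬pb = crossing P? p pj ¬py in a , b , e ◅ q , e′ , r , pa , ¬pb

-- Deleting an edge of a tree.

Minus : {A : Set} → Rel A 0ℓ → A → A → Rel A 0ℓ
Minus R a b u v = R u v × ¬ ((u ≡ a × v ≡ b) ⊎ (u ≡ b × v ≡ a))

Minus-sym : {A : Set} {R : Rel A 0ℓ} {a b : A} → Symmetric R → Symmetric (Minus R a b)
Minus-sym symR (r , other) = symR r , other ∘ swap ∘ [ (λ (p , q) → inj₁ (q , p)) , (λ (p , q) → inj₂ (q , p)) ]′

Minus-flip : {A : Set} {R : Rel A 0ℓ} {a b u v : A} → Minus R a b u v → Minus R b a u v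
Minus-flip (r , other) = r , other ∘ swap

module _ {A : Set} {R : Rel A 0ℓ} where

  avoiding-start : ∀ {a b x y} (p : Star R x y) → a ∉ˡ vertices p → Star (Minus R a b) x y
  avoiding-start ε       a∉ = ε
  avoiding-start (r ◅ p) a∉ =
    (r , λ { (inj₁ (refl , _)) → a∉ (here refl) ; (inj₂ (_ , refl)) → a∉ (there (start∈ p)) })
    ◅ avoiding-start p (a∉ ∘ there)

  -- The first step stops short of `b` because the path goes on, and the later steps avoid `a` by
  -- distinctness.
  avoiding-ends : ∀ {a b} (p : Star R a b) → Unique (vertices p) → 3 ≤ length (vertices p) →
    Star (Minus R a b) a b
  avoiding-ends ε _ (s≤s ())
  avoiding-ends (_ ◅ ε) _ (s≤s (s≤s ()))
  avoiding-ends {a} {b} (r ◅ p@(_◅_ {i = x} _ q)) (a∉ ∷ (x∉ ∷ _)) _ =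
    (r , λ { (inj₁ (_ , refl)) → All.lookup x∉ (end∈ q) refl
           ; (inj₂ (_ , refl)) → All.lookup a∉ (here refl) refl })
    ◅ avoiding-start p λ a∈ → All.lookup a∉ a∈ refl

module Tree {R : Rel (Fin n) 0ℓ} (symR : Symmetric R) (irrefl : ∀ {v} → ¬ R v v) (isTree : IsTree R) where
  open IsTree isTree

  -- A simple walk between the ends of an edge that avoids this edge has at least three vertices, so
  -- the edge would close it to a cycle of the tree.
  bridge : ∀ {a b} → R a b → ¬ Star (Minus R a b) a b
  bridge {a} {b} r p = shape q refl refl
    where
    q : Star (Minus R a b) a b
    q = proj₁ (simplify p)
    short : ¬ 3 ≤ length (vertices q)
    short long = acyclic (Star.map proj₁ q) (symR r)
      (subst Unique (sym (map-vertices proj₁ q)) (proj₁ (proj₂ (simplify p))))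
      (subst (λ xs → 3 ≤ length xs) (sym (map-vertices proj₁ q)) long)
    shape : ∀ {c} (q′ : Star (Minus R a b) a c) (eq : c ≡ b) → q ≡ subst (Star (Minus R a b) a) eq q′ → ⊥
    shape ε refl _ = irrefl r
    shape ((_ , other) ◅ ε) refl _ = other (inj₁ (refl , refl))
    shape (_ ◅ (_ ◅ q″)) refl eq = short (subst (λ z → 3 ≤ length (vertices z)) (sym eq) (s≤s (s≤s (positive q″))))

  -- A walk from `a` to `u` is followed while keeping a walk in the cut tree to the current vertex;
  -- whenever the deleted edge is crossed, that walk restarts at the end just reached.
  two-sides : ∀ a b u → Star (Minus R a b) a u ⊎ Star (Minus R a b) b u
  two-sides a b u = go (connected a u) (inj₁ ε)
    where
    W = Minus R a b
    go : ∀ {x u} → Star R x u → Star W a x ⊎ Star W b x → Star W a u ⊎ Star W b u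
    go ε reached = reached
    go (_◅_ {i = x} {j = y} r p) reached with ((x ≟ a) ×-dec (y ≟ b)) ⊎-dec ((x ≟ b) ×-dec (y ≟ a))
    ... | yes (inj₁ (_ , refl)) = go p (inj₂ ε)
    ... | yes (inj₂ (_ , refl)) = go p (inj₁ ε)
    ... | no other = go p ([ (λ q → inj₁ (q ◅◅ (r , other) ◅ ε)) , (λ q → inj₂ (q ◅◅ (r , other) ◅ ε)) ]′ reached)

-- Rooted trees from a parent function with a decreasing rank.

module Rooted (root : Fin n) (par : Fin n → Fin n) (rank : Fin n → ℕ)
  (rank-par : ∀ {x} → x ≢ root → rank (par x) < rank x) where

  Up : Rel (Fin n) 0ℓ
  Up x y = x ≢ root × par x ≡ y

  infix 4 _⊑_
  _⊑_ : Rel (Fin n) 0ℓ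
  _⊑_ = Star Up

  ⊑-root : ∀ x → x ⊑ root
  ⊑-root x = go (rank x) x ≤-refl
    where
    go : ∀ k x → rank x ≤ k → x ⊑ root
    go k x rank≤ with x ≟ root
    ... | yes refl = ε
    go zero    x rank≤ | no x≢ = contradiction (<-≤-trans (rank-par x≢) rank≤) λ ()
    go (suc k) x rank≤ | no x≢ =
      (x≢ , refl) ◅ go k (par x) (ℕₚ.≤-pred (<-≤-trans (rank-par x≢) rank≤))

  ⊑-rank : ∀ {x y} → x ⊑ y → rank y ≤ rank x
  ⊑-rank ε = ≤-refl
  ⊑-rank ((x≢ , refl) ◅ p) = ≤-trans (⊑-rank p) (ℕₚ.<⇒≤ (rank-par x≢))

  par⋢ : ∀ {x} → x ≢ root → ¬ par x ⊑ x
  par⋢ x≢ p = <-irrefl refl (≤-<-trans (⊑-rank p) (rank-par x≢))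

  last-step : ∀ {x y a} → Up x y → y ⊑ a → ∃[ b ] x ⊑ b × Up b a
  last-step u ε       = _ , ε , u
  last-step u (v ◅ p) = let b , q , w = last-step v p in b , u ◅ q , w

  module _ {_~_ : Rel (Fin n) 0ℓ} (to : ∀ {u v} → u ~ v → Up u v ⊎ Up v u) where

    -- The only step out of the part below `c` leads from `c` to `par c`, and it is deleted; any
    -- other upward step only shortens the ascent to `c`.
    ⊑-invariant : ∀ {c u v} → Star (Minus _~_ c (par c)) u v → u ⊑ c → v ⊑ c
    ⊑-invariant ε u⊑c = u⊑c
    ⊑-invariant ((e , other) ◅ p) u⊑c with to e
    ... | inj₂ up = ⊑-invariant p (up ◅ u⊑c)
    ... | inj₁ (u≢ , refl) with u⊑c
    ...   | ε = contradiction (inj₁ (refl , refl)) other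
    ...   | (_ , refl) ◅ q = ⊑-invariant p q

    module _ (from : ∀ {u v} → Up u v → u ~ v × v ~ u) where

      private
        ~-sym : Symmetric _~_
        ~-sym e = [ proj₂ ∘ from , proj₁ ∘ from ]′ (to e)

        ⊑⇒~ : ∀ {x y} → x ⊑ y → Star _~_ x y
        ⊑⇒~ = Star.map (proj₁ ∘ from)

      -- A cycle would join a vertex to its parent without using the edge between them; by
      -- invariance the parent would then lie below its child.
      isTree : IsTree _~_
      isTree .IsTree.connected u v = ⊑⇒~ (⊑-root u) ◅◅ reverse ~-sym (⊑⇒~ (⊑-root v))
      isTree .IsTree.acyclic p e unique long with to e | avoiding-ends p unique long
      ... | inj₁ (v≢ , refl) | q =
        par⋢ v≢ (⊑-invariant (reverse (Minus-sym {R = _~_} ~-sym) (Star.map (Minus-flip {R = _~_}) q)) ε)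
      ... | inj₂ (u≢ , refl) | q = par⋢ u≢ (⊑-invariant q ε)

  up? : ∀ u v → Dec (Up u v)
  up? u v = ¬? (u ≟ root) ×-dec (par u ≟ v)

  module _ {{_ : NonZero n}} where

    arborescence : Digraph
    arborescence .Digraph.order = n
    arborescence .Digraph.edge u v = does (up? v u)
    arborescence .Digraph.loopless v t with T-does (up? v v) t
    ... | v≢ , eq = <-irrefl (cong rank eq) (rank-par v≢)

    edge⇒up : ∀ {u v} → Edge arborescence u v → Up v u
    edge⇒up {u} {v} = T-does (up? v u)

    up⇒edge : ∀ {u v} → Up v u → Edge arborescence u v
    up⇒edge {u} {v} = does-T (up? v u)

    walk⇒⊑ : ∀ {u v} → Walk arborescence u v → v ⊑ u
    walk⇒⊑ = Star.reverse edge⇒up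

    ⊑⇒walk : ∀ {u v} → v ⊑ u → Walk arborescence u v
    ⊑⇒walk = Star.reverse up⇒edge

    isArborescence : IsArborescence arborescence
    isArborescence .IsArborescence.oriented e e′ with edge⇒up e | edge⇒up e′
    ... | v≢ , refl | u = par⋢ v≢ (u ◅ ε)
    isArborescence .IsArborescence.underlying = isTree
      (λ { (fwd e) → inj₂ (edge⇒up e) ; (bwd e) → inj₁ (edge⇒up e) })
      (λ u → bwd (up⇒edge u) , fwd (up⇒edge u))
    isArborescence .IsArborescence.root = root , (λ t → ⊑⇒walk (⊑-root t)) ,
      λ reach → stop (walk⇒⊑ (reach root))
      where
      stop : ∀ {y} → root ⊑ y → root ≡ y
      stop ε              = refl
      stop ((≢root , _) ◅ _) = contradiction refl ≢root

-- Bags and guards of a tree decomposition.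

orEmpty⁺ : ∀ b {f : T b → Subset n} {v} (t : T b) → v ∈ f t → v ∈ orEmpty b f
orEmpty⁺ true _ v∈ = v∈

orEmpty⁻ : ∀ b {f : T b → Subset n} {v} → v ∈ orEmpty b f → ∃[ t ] v ∈ f t
orEmpty⁻ true  v∈ = tt , v∈
orEmpty⁻ false v∈ = contradiction v∈ ∉⊥

module _ {D : Digraph} (𝒯 : TreeDecomposition D) where
  open TreeDecomposition 𝒯

  private
    guard : V tree → V tree → Subset (order D)
    guard t s = orEmpty (edge tree s t) (γ s t) ∪ orEmpty (edge tree t s) (γ t s)

  Γ⁻ : ∀ t {v} → v ∈ Γ t →
    v ∈ β t ⊎ (∃[ s ] Σ (Edge tree s t) λ e → v ∈ γ s t e)
            ⊎ (∃[ s ] Σ (Edge tree t s) λ e → v ∈ γ t s e)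
  Γ⁻ t {v} v∈ with x∈p∪q⁻ (β t) (⋃ (map (guard t) (allFin (order tree)))) v∈
  ... | inj₁ v∈β = inj₁ v∈β
  ... | inj₂ v∈⋃ with ∈-⋃⁻ (map (guard t) (allFin (order tree))) v∈⋃
  ...   | _ , Q∈ , v∈Q with ∈-map⁻ (guard t) Q∈
  ...     | s , _ , refl with x∈p∪q⁻ (orEmpty (edge tree s t) (γ s t)) (orEmpty (edge tree t s) (γ t s)) v∈Q
  ...       | inj₁ v∈in  = inj₂ (inj₁ (s , orEmpty⁻ (edge tree s t) v∈in))
  ...       | inj₂ v∈out = inj₂ (inj₂ (s , orEmpty⁻ (edge tree t s) v∈out))

  β⊆Γ : ∀ t → β t ⊆ Γ t
  β⊆Γ t = p⊆p∪q _

  γ⊆Γ : ∀ t s (e : Edge tree t s) → γ t s e ⊆ Γ t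
  γ⊆Γ t s e v∈ = q⊆p∪q (β t) _ (∈-⋃⁺ (∈-map⁺ (guard t) (∈-allFin s))
    (q⊆p∪q (orEmpty (edge tree s t) (γ s t)) _ (orEmpty⁺ (edge tree t s) e v∈)))

  ∣Γ∣≤ : ∀ t → ∣ Γ t ∣ ≤ suc width
  ∣Γ∣≤ t = ≤-trans
    (All.lookup (xs≤max 0 (map (∣_∣ ∘ Γ) (allFin (order tree)))) (∈-map⁺ (∣_∣ ∘ Γ) (∈-allFin t)))
    (ℕₚ.m≤n+m∸n _ 1)

-- Tree decompositions with singleton bags by successive refinement.

-- A state s stands for a subtree of a decomposition with one vertex per bag:
-- W s is the set of its vertices, r s its root, and next s x its child subtree
-- containing x.
record Refinement (D : Digraph) (b : ℕ) : Set₁ where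
  field
    State   : Set
    W G K   : State → Subset (order D)
    r       : State → V D
    next    : State → V D → State
    Inv     : State → Set
    r∈W     : ∀ {s} → Inv s → r s ∈ W s
    next∈   : ∀ {s x} → Inv s → x ∈ W s → x ≢ r s → x ∈ W (next s x)
    next⊆   : ∀ {s x y} → Inv s → x ∈ W s → x ≢ r s → y ∈ W (next s x) → y ∈ W s × y ≢ r s
    next≡   : ∀ {s x y} → Inv s → x ∈ W s → x ≢ r s → y ∈ W (next s x) → next s y ≡ next s x
    next-inv : ∀ {s x} → Inv s → x ∈ W s → x ≢ r s → Inv (next s x)
    s₀      : State
    s₀-inv  : Inv s₀
    s₀-all  : ∀ x → x ∈ W s₀
    guards  : ∀ {s} → Inv s → ∀ {x y} (p : Walk D x y) → x ∈ W s → y ∈ W s →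
              Any (_∉ W s) (vertices p) → G s meets vertices p
    G⊆K     : ∀ {s} → Inv s → G s ⊆ K s
    r∈K     : ∀ {s} → Inv s → r s ∈ K s
    Gnext⊆K : ∀ {s x} → Inv s → x ∈ W s → x ≢ r s → G (next s x) ⊆ K s
    ∣K∣≤    : ∀ {s} → Inv s → ∣ K s ∣ ≤ b

module _ {D : Digraph} {b : ℕ} (ℛ : Refinement D b) where
  open Refinement ℛ
  private
    N = order D

    instance
      N≢0 : NonZero N
      N≢0 = Digraph.nonEmpty D

    -- The state with root x, preceded by the state of its parent.
    run : ℕ → State → State → Fin N → State × State
    -- The fuel is kept at least `∣ W s ∣`, which falls with every step, so this default is not
    -- reached while `x` lies in `W s`.
    run zero    p s x = p , s
    run (suc f) p s x with x ≟ r s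
    ... | yes _ = p , s
    ... | no  _ = run f s (next s x) x

    run-stop : ∀ f p s → run (suc f) p s (r s) ≡ (p , s)
    run-stop f p s with r s ≟ r s
    ... | yes _ = refl
    ... | no ¬eq = contradiction refl ¬eq

    run-step : ∀ f p s {x} → x ≢ r s → run (suc f) p s x ≡ run f s (next s x) x
    run-step f p s {x} x≢ with x ≟ r s
    ... | yes eq = contradiction eq x≢
    ... | no _ = refl

    next⊂ : ∀ {s x} → Inv s → x ∈ W s → x ≢ r s → W (next s x) ⊂ W s
    next⊂ {s} inv x∈ x≢ = proj₁ ∘ next⊆ inv x∈ x≢ ,
      r s , r∈W inv , λ r∈ → proj₂ (next⊆ inv x∈ x≢ r∈) refl

    empty-W : ∀ {s x} {A : Set} → x ∈ W s → ∣ W s ∣ ≤ 0 → A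
    empty-W {s} {x} x∈ ∣W∣≤0 = contradiction
      (≤-trans (≤-reflexive (sym (∣⁅x⁆∣≡1 x)))
        (≤-trans (p⊆q⇒∣p∣≤∣q∣ λ y∈ → subst (_∈ W s) (sym (x∈⁅y⁆⇒x≡y x y∈)) x∈) ∣W∣≤0))
      λ ()

    smaller : ∀ {f s x} → Inv s → x ∈ W s → x ≢ r s → ∣ W s ∣ ≤ suc f → ∣ W (next s x) ∣ ≤ f
    smaller inv x∈ x≢ small = ℕₚ.≤-pred (<-≤-trans (p⊂q⇒∣p∣<∣q∣ (next⊂ inv x∈ x≢)) small)

    run-final : ∀ f p s x → Inv s → x ∈ W s → ∣ W s ∣ ≤ f →
      let t = proj₂ (run f p s x) in Inv t × r t ≡ x × W t ⊆ W s
    run-final zero    p s x inv x∈ small = empty-W x∈ small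
    run-final (suc f) p s x inv x∈ small with x ≟ r s
    ... | yes refl = inv , refl , id
    ... | no x≢ =
      let inv′ , r≡ , W⊆ = run-final f s (next s x) x (next-inv inv x∈ x≢) (next∈ inv x∈ x≢)
                             (smaller inv x∈ x≢ small)
      in inv′ , r≡ , proj₁ ∘ next⊆ inv x∈ x≢ ∘ W⊆

    -- Specifies `q` as the state just before `t` on the run toward `x`. The field `run-rq`
    -- identifies `q` with the state that the root of `q`, the parent of `x`, receives from its own
    -- run.
    record Precedes (f : ℕ) (s : State) (x : Fin N) (q t : State) : Set where
      field
        q-inv  : Inv q
        x∈Wq   : x ∈ W q
        x≢rq   : x ≢ r q
        t≡next : t ≡ next q x
        Wq⊆Ws  : W q ⊆ W s
        run-rq : ∀ p → proj₂ (run f p s (r q)) ≡ q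

    -- The runs toward `x` and toward the root of the preceding state agree up to that state,
    -- because `next≡` assigns one state to all vertices of a child subtree.
    run-previous : ∀ f p s x → Inv s → x ∈ W s → x ≢ r s → ∣ W s ∣ ≤ f →
      Precedes f s x (proj₁ (run f p s x)) (proj₂ (run f p s x))
    run-previous zero    p s x inv x∈ x≢ small = empty-W x∈ small
    run-previous (suc zero) p s x inv x∈ x≢ small =
      empty-W (next∈ inv x∈ x≢) (smaller inv x∈ x≢ small)
    run-previous (suc f@(suc f′)) p s x inv x∈ x≢ small =
      subst (λ (q , t) → Precedes (suc f) s x q t) (sym (run-step f p s x≢)) (step (x ≟ r s′)
        λ x≢r → run-previous f s s′ x (next-inv inv x∈ x≢) (next∈ inv x∈ x≢) x≢r (smaller inv x∈ x≢ small))
      where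
      s′ = next s x
      step : Dec (x ≡ r s′) →
        (x ≢ r s′ → Precedes f s′ x (proj₁ (run f s s′ x)) (proj₂ (run f s s′ x))) →
        Precedes (suc f) s x (proj₁ (run f s s′ x)) (proj₂ (run f s s′ x))
      step (yes x≡) _ = subst (λ (q , t) → Precedes (suc f) s x q t)
        (sym (trans (cong (run f s s′) x≡) (run-stop f′ s s′))) (record
          { q-inv = inv ; x∈Wq = x∈ ; x≢rq = x≢ ; t≡next = refl ; Wq⊆Ws = id
          ; run-rq = λ p → cong proj₂ (run-stop f p s) })
      step (no x≢r) ih = record
        { q-inv = q-inv ; x∈Wq = x∈Wq ; x≢rq = x≢rq ; t≡next = t≡next
        ; Wq⊆Ws = proj₁ ∘ next⊆ inv x∈ x≢ ∘ Wq⊆Ws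
        ; run-rq = λ p → trans
            (cong proj₂ (run-step f p s (proj₂ rq∈)))
            (trans (cong (λ s″ → proj₂ (run f s s″ (r (proj₁ (run f s s′ x))))) (next≡ inv x∈ x≢ (Wq⊆Ws (r∈W q-inv))))
              (run-rq s)) }
        where
        open Precedes (ih x≢r)
        rq∈ = next⊆ inv x∈ x≢ (Wq⊆Ws (r∈W q-inv))

    -- This keeps the ascent from a vertex of the subtree at `x` inside that subtree until it meets
    -- `x`. The runs toward `x` and `y` agree until `x` becomes the root; from there the run toward
    -- `y` passes through subsets only.
    run-closed : ∀ f p s x y → Inv s → x ∈ W s → ∣ W s ∣ ≤ f →
      y ∈ W (proj₂ (run f p s x)) → y ≢ x →
      y ≢ r s × r (proj₁ (run f p s y)) ∈ W (proj₂ (run f p s x))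
    run-closed zero    p s x y inv x∈ small y∈ y≢x = empty-W x∈ small
    run-closed (suc f) p s x y inv x∈ small y∈ y≢x with x ≟ r s
    ... | yes refl = y≢x , Precedes.Wq⊆Ws prec (r∈W (Precedes.q-inv prec))
      where prec = run-previous (suc f) p s y inv y∈ y≢x small
    ... | no x≢ = y≢r ,
      subst (λ (q , _) → r q ∈ W t)
        (sym (trans (run-step f p s y≢r) (cong (λ s″ → run f s s″ y) (next≡ inv x∈ x≢ y∈s′))))
        (proj₂ (run-closed f s (next s x) x y (next-inv inv x∈ x≢) x∈s′ small′ y∈ y≢x))
      where
      t = proj₂ (run f s (next s x) x)
      x∈s′ = next∈ inv x∈ x≢
      small′ = smaller inv x∈ x≢ small
      y∈s′ = proj₂ (proj₂ (run-final f s (next s x) x (next-inv inv x∈ x≢) x∈s′ small′)) y∈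
      y≢r = proj₂ (next⊆ inv x∈ x≢ y∈s′)

    P S : Fin N → State
    P x = proj₁ (run N s₀ s₀ x)
    S x = proj₂ (run N s₀ s₀ x)

    root : Fin N
    root = r s₀

    par : Fin N → Fin N
    par x = r (P x)

    S-final : ∀ x → Inv (S x) × r (S x) ≡ x × W (S x) ⊆ W s₀
    S-final x = run-final N s₀ s₀ x s₀-inv (s₀-all x) (∣p∣≤n (W s₀))

    S-inv : ∀ x → Inv (S x)
    S-inv = proj₁ ∘ S-final

    x∈WSx : ∀ x → x ∈ W (S x)
    x∈WSx x = subst (_∈ W (S x)) (proj₁ (proj₂ (S-final x))) (r∈W (S-inv x))

    previous : ∀ {x} → x ≢ root → Precedes N s₀ x (P x) (S x)
    previous {x} x≢ = run-previous N s₀ s₀ x s₀-inv (s₀-all x) x≢ (∣p∣≤n (W s₀))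

    S-par : ∀ {x} → x ≢ root → S (par x) ≡ P x
    S-par x≢ = Precedes.run-rq (previous x≢) s₀

    WS⊂WSpar : ∀ {x} → x ≢ root → W (S x) ⊂ W (S (par x))
    WS⊂WSpar {x} x≢ = subst₂ (λ t q → W t ⊂ W q) (sym t≡next) (sym (S-par x≢)) (next⊂ q-inv x∈Wq x≢rq)
      where open Precedes (previous x≢)

    -- The sets `W` shrink strictly away from the root, so the sizes of their complements increase
    -- strictly from parent to child.
    open Rooted root par (λ x → N ∸ ∣ W (S x) ∣)
      (λ {x} x≢ → ℕₚ.∸-monoʳ-< (p⊂q⇒∣p∣<∣q∣ (WS⊂WSpar x≢)) (∣p∣≤n (W (S (par x)))))

    ⊑⇒∈W : ∀ {x y} → y ⊑ x → y ∈ W (S x)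
    ⊑⇒∈W {x} {y} p = mono p (x∈WSx y)
      where
      mono : ∀ {y x} → y ⊑ x → W (S y) ⊆ W (S x)
      mono ε = id
      mono ((y≢ , refl) ◅ p) = mono p ∘ proj₁ (WS⊂WSpar y≢)

    ∈W⇒⊑ : ∀ {x y} → y ∈ W (S x) → y ⊑ x
    ∈W⇒⊑ {x} {y} = go y (⊑-root y)
      where
      go : ∀ y → y ⊑ root → y ∈ W (S x) → y ⊑ x
      go y y⊑root y∈ with y ≟ x
      ... | yes refl = ε
      ... | no y≢x with run-closed N s₀ s₀ x y s₀-inv (s₀-all x) (∣p∣≤n (W s₀)) y∈ y≢x | y⊑root
      ...   | y≢root , par∈ | ε = contradiction refl y≢root
      ...   | y≢root , par∈ | (_ , refl) ◅ p = (y≢root , refl) ◅ go (par y) p par∈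

  decomposition : TreeDecomposition D
  decomposition = record
    { tree = arborescence
    ; isArborescence = isArborescence
    ; β = ⁅_⁆
    ; β-nonempty = λ t → t , x∈⁅x⁆ t
    ; β-partition = λ v → v , x∈⁅x⁆ v , λ {t} v∈ → x∈⁅y⁆⇒x≡y t v∈
    ; γ = λ _ t _ → G (S t)
    ; γ-guards = λ {d} {t} e p x-below y-below outside →
        guards (S-inv t) p (below⇒ x-below) (below⇒ y-below)
          (Any.map (λ {v} ¬below v∈ → ¬below (v , ⊑⇒walk (∈W⇒⊑ v∈) , x∈⁅x⁆ v)) outside)
    }
    where
    below⇒ : ∀ {t x} → (∃[ t′ ] Walk arborescence t t′ × x ∈ ⁅ t′ ⁆) → x ∈ W (S t)
    below⇒ (t′ , walk , x∈) with refl ← x∈⁅y⁆⇒x≡y t′ x∈ = ⊑⇒∈W (walk⇒⊑ walk)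

  Γ⊆K : ∀ t → TreeDecomposition.Γ decomposition t ⊆ K (S t)
  Γ⊆K t {v} v∈ with Γ⁻ decomposition t v∈
  ... | inj₁ v∈⁅t⁆ = subst (_∈ K (S t))
    (trans (proj₁ (proj₂ (S-final t))) (sym (x∈⁅y⁆⇒x≡y t v∈⁅t⁆))) (r∈K (S-inv t))
  ... | inj₂ (inj₁ (_ , _ , v∈G)) = G⊆K (S-inv t) v∈G
  ... | inj₂ (inj₂ (s , e , v∈G)) with edge⇒up e
  -- The state preceding that of the child `s` is the state of `t`, whose `K` covers the guards of
  -- all its child subtrees.
  ...   | s≢ , refl = subst (λ q → v ∈ K q) (sym (S-par s≢))
      (Gnext⊆K q-inv x∈Wq x≢rq (subst (λ q → v ∈ G q) t≡next v∈G))
      where open Precedes (previous s≢)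

  width≤ : TreeDecomposition.width decomposition ≤ b ∸ 1
  width≤ = ℕₚ.∸-monoˡ-≤ 1 (max≤v⁺ {⊥ = 0} {xs = map (λ t → ∣ TreeDecomposition.Γ decomposition t ∣) (allFin N)}
    z≤n (AllP.map⁺ (All.tabulate λ {t} _ → ≤-trans (p⊆q⇒∣p∣≤∣q∣ (Γ⊆K t)) (∣K∣≤ (S-inv t)))))

-- Strong components after deleting a vertex set

module StrongComponents (D : Digraph) where

  Avoid : Subset (order D) → Rel (V D) 0ℓ
  Avoid Z u v = Edge D u v × u ∉ Z × v ∉ Z

  -- Both walks may be empty, so `x ∉ Z` has to be demanded; `y ∉ Z` then follows along the first
  -- walk.
  SC : Subset (order D) → Rel (V D) 0ℓ
  SC Z x y = x ∉ Z × Star (Avoid Z) x y × Star (Avoid Z) y x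

  avoid : ∀ {Z x y} (p : Walk D x y) → ¬ (Z meets vertices p) → Star (Avoid Z) x y
  avoid ε       _  = ε
  avoid (e ◅ p) ¬m = (e , ¬m ∘ here , ¬m ∘ there ∘ lose (start∈ p)) ◅ avoid p (¬m ∘ there)

  avoid-end : ∀ {Z x y} → x ∉ Z → Star (Avoid Z) x y → y ∉ Z
  avoid-end x∉ ε                     = x∉
  avoid-end x∉ ((_ , _ , y∉) ◅ p) = avoid-end y∉ p

  SC-refl : ∀ {Z x} → x ∉ Z → SC Z x x
  SC-refl x∉ = x∉ , ε , ε

  SC-sym : ∀ {Z} → Symmetric (SC Z)
  SC-sym (x∉ , p , q) = avoid-end x∉ p , q , p

  SC-trans : ∀ {Z x y z} → SC Z x y → SC Z y z → SC Z x z
  SC-trans (x∉ , p , q) (_ , p′ , q′) = x∉ , p ◅◅ p′ , q′ ◅◅ q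

  SC-antitone : ∀ {X Z x y} → X ⊆ Z → SC Z x y → SC X x y
  SC-antitone X⊆Z (x∉ , p , q) = x∉ ∘ X⊆Z , weaken p , weaken q
    where weaken = Star.map λ (e , u∉ , v∉) → e , u∉ ∘ X⊆Z , v∉ ∘ X⊆Z

  SC-vertices : ∀ {Z x y w} → SC Z x y → (p : Star (Avoid Z) x y) → w ∈ˡ vertices p → SC Z x w
  SC-vertices (x∉ , _ , back) p w∈ = x∉ , proj₁ (prefix p w∈) , proj₁ (suffix p w∈) ◅◅ back

-- A tree decomposition from balanced separators.

pick : Subset n → Fin n → Fin n
pick S d with nonempty? S
... | yes (x , _) = x
... | no _        = d

pick∈ : (S : Subset n) (d : Fin n) → Nonempty S → pick S d ∈ S
pick∈ S d ne with nonempty? S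
... | yes (_ , x∈) = x∈
... | no ¬ne       = contradiction ne ¬ne

module BalancedSeparators (D : Digraph) (k : ℕ) (SC? : ∀ Z x y → Dec (StrongComponents.SC D Z x y)) where
  open StrongComponents D

  comp : Subset (order D) → V D → Subset (order D)
  comp Z x = subsetOf (SC? Z x)

  ∈-comp⁺ : ∀ {Z x y} → SC Z x y → y ∈ comp Z x
  ∈-comp⁺ {Z} {x} = ∈-subsetOf⁺ (SC? Z x)

  ∈-comp⁻ : ∀ {Z x y} → y ∈ comp Z x → SC Z x y
  ∈-comp⁻ {Z} {x} = ∈-subsetOf⁻ (SC? Z x)

  comp≡ : ∀ {Z x y} → SC Z x y → comp Z y ≡ comp Z x
  comp≡ xy = ⊆-antisym (∈-comp⁺ ∘ SC-trans xy ∘ ∈-comp⁻) (∈-comp⁺ ∘ SC-trans (SC-sym xy) ∘ ∈-comp⁻)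

  -- The restriction `x ∉ Z` matters when `k` is 0: if the chosen node is the leaf of a vertex of
  -- `Z`, the component of that vertex may consist of it alone and still meet `Z`.
  Balanced : Subset (order D) → Subset (order D) → Set
  Balanced Z X = ∀ {x} → x ∉ X → x ∉ Z → ∣ Z ∩ comp X x ∣ ≤ 3 * k

  module _ (sep : Subset (order D) → Subset (order D))
    (∣sep∣≤ : ∀ Z → ∣ Z ∣ ≤ 6 * k + 1 → ∣ sep Z ∣ ≤ 3 * k)
    (balanced : ∀ Z → ∣ Z ∣ ≤ 6 * k + 1 → Balanced Z (sep Z)) where

    private
      N = order D

      x₀ : Fin N
      x₀ = some N {{Digraph.nonEmpty D}}

      -- `W` holds the vertices still to be placed, `Z` is the set from which the current chain of
      -- bags started, `X` is its separator with one vertex of the initial `W` added, and `G` guards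
      -- the tree edge into the subtree.
      record State : Set where
        constructor ⟨_,_,_,_⟩
        field W Z X G : Subset N
      open State

      r : State → Fin N
      r s = pick (W s ∩ X s) x₀

      K : State → Subset N
      K s = Z s ∪ X s

      rest : State → Subset N
      rest s = (W s - r s) ∩ X s

      enter : Subset N → Subset N → State
      enter W Z = ⟨ W , Z , sep Z ∪ ⁅ pick W x₀ ⁆ , Z ⟩

      Z″ : State → Fin N → Subset N
      Z″ s x = X s ∪ (Z s ∩ comp (X s) x)

      -- The vertices of W ∩ X form a chain of bags; below its last vertex
      -- hang the strong components of what is left.
      step : (s : State) → Dec (Nonempty (rest s)) → Fin N → State
      step s (yes _) x = ⟨ W s - r s , Z s , X s , K s ⟩
      step s (no _)  x = enter (comp (Z″ s x) x) (Z″ s x)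

      record Inv (s : State) : Set where
        field
          nonempty : Nonempty (W s ∩ X s)
          ∣Z∣≤     : ∣ Z s ∣ ≤ 6 * k + 1
          ∣X∣≤     : ∣ X s ∣ ≤ 3 * k + 1
          splits   : Balanced (Z s) (X s)
          disjoint : ∀ {x} → x ∈ W s → x ∉ Z s
          guarded  : ∀ {x y} (p : Walk D x y) → x ∈ W s → y ∈ W s →
                     Any (_∉ W s) (vertices p) → G s meets vertices p
          G⊆       : G s ⊆ K s

      enter-inv : ∀ {W Z} → Nonempty W → ∣ Z ∣ ≤ 6 * k + 1 → (∀ {x} → x ∈ W → x ∉ Z) →
        (∀ {x y} (p : Walk D x y) → x ∈ W → y ∈ W → Any (_∉ W) (vertices p) → Z meets vertices p) →
        Inv (enter W Z)
      enter-inv {W} {Z} ne small disjoint guarded = record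
        { nonempty = pick W x₀ , x∈p∩q⁺ (pick∈ W x₀ ne , q⊆p∪q (sep Z) _ (x∈⁅x⁆ _))
        ; ∣Z∣≤ = small
        ; ∣X∣≤ = ≤-trans (∣p∪q∣≤∣p∣+∣q∣ (sep Z) _) (+-mono-≤ (∣sep∣≤ Z small) (≤-reflexive (∣⁅x⁆∣≡1 (pick W x₀))))
        -- Deleting one vertex more only shrinks the components, so the balance of `sep Z` is
        -- inherited.
        ; splits = λ {x} x∉X x∉Z → ≤-trans
            (p⊆q⇒∣p∣≤∣q∣ λ y∈ → let y∈Z , y∈comp = x∈p∩q⁻ Z _ y∈ in
              x∈p∩q⁺ (y∈Z , ∈-comp⁺ (SC-antitone (p⊆p∪q _) (∈-comp⁻ y∈comp))))
            (balanced Z small (x∉X ∘ p⊆p∪q _) x∉Z)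
        ; disjoint = disjoint
        ; guarded = guarded
        ; G⊆ = p⊆p∪q _
        }

      -- A walk that avoids `Z` and has both ends in one strong component can be closed up there, so
      -- all its vertices belong to the component.
      comp-guarded : ∀ {Z z x y} (p : Walk D x y) → x ∈ comp Z z → y ∈ comp Z z →
        Any (_∉ comp Z z) (vertices p) → Z meets vertices p
      comp-guarded {Z} {z} p x∈ y∈ out with Any.any? (_∈ₛ? Z) (vertices p)
      ... | yes meets = meets
      ... | no ¬meets = contradiction
        (∈-comp⁺ (SC-trans zx (SC-vertices (SC-trans (SC-sym zx) (∈-comp⁻ y∈)) p′ w∈′))) w∉
        where
        zx = ∈-comp⁻ x∈
        p′ = avoid p ¬meets
        vertices≡ : ∀ {x y} (p : Walk D x y) (¬m : ¬ (Z meets vertices p)) → vertices (avoid p ¬m) ≡ vertices p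
        vertices≡ ε       _  = refl
        vertices≡ (_ ◅ p) ¬m = cong (_ ∷_) (vertices≡ p (¬m ∘ there))
        w∈w∉ = find out
        w∉ = proj₂ (proj₂ w∈w∉)
        w∈′ = subst (proj₁ w∈w∉ ∈ˡ_) (sym (vertices≡ p ¬meets)) (proj₁ (proj₂ w∈w∉))

      r∈W∩X : ∀ {s} → Inv s → r s ∈ W s × r s ∈ X s
      r∈W∩X {s} inv = x∈p∩q⁻ (W s) (X s) (pick∈ (W s ∩ X s) x₀ (Inv.nonempty inv))

      module Component {s x} (inv : Inv s) (x∈ : x ∈ W s) (x≢ : x ≢ r s) (¬rest : ¬ Nonempty (rest s)) where
        open Inv inv

        x∉X : x ∉ X s
        x∉X x∈X = ¬rest (x , x∈p∩q⁺ (x∈p∧x≢y⇒x∈p-y x∈ x≢ , x∈X))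

        x∉Z : x ∉ Z s
        x∉Z = disjoint x∈

        x∉Z″ : x ∉ Z″ s x
        x∉Z″ x∈Z″ with x∈p∪q⁻ (X s) _ x∈Z″
        ... | inj₁ x∈X = x∉X x∈X
        ... | inj₂ x∈∩ = x∉Z (p∩q⊆p (Z s) _ x∈∩)

        X⊆Z″ : X s ⊆ Z″ s x
        X⊆Z″ = p⊆p∪q _

        Z″⊆K : Z″ s x ⊆ K s
        Z″⊆K y∈ with x∈p∪q⁻ (X s) _ y∈
        ... | inj₁ y∈X = q⊆p∪q (Z s) (X s) y∈X
        ... | inj₂ y∈∩ = p⊆p∪q (X s) (p∩q⊆p (Z s) _ y∈∩)

        -- A vertex of `Z` in the component would also lie in the component of `x` after deleting
        -- only `X s`, and `Z″` contains every vertex of `Z` there.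
        SC-avoids-K : ∀ {y} → SC (Z″ s x) x y → y ∉ K s
        SC-avoids-K xy y∈K with x∈p∪q⁻ (Z s) (X s) y∈K
        ... | inj₂ y∈X = avoid-end (proj₁ xy) (proj₁ (proj₂ xy)) (X⊆Z″ y∈X)
        ... | inj₁ y∈Z = avoid-end (proj₁ xy) (proj₁ (proj₂ xy))
          (q⊆p∪q (X s) _ (x∈p∩q⁺ (y∈Z , ∈-comp⁺ (SC-antitone X⊆Z″ xy))))

        -- A vertex of the component outside `W s` would give a closed walk through `x` that leaves
        -- `W s` and hence meets `G s`; but `G s` lies in `K s`, which the component avoids.
        SC⇒∈W : ∀ {y} → SC (Z″ s x) x y → y ∈ W s
        SC⇒∈W {y} xy@(x∉ , p , q) with y ∈ₛ? W s
        ... | yes y∈ = y∈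
        ... | no y∉ = contradiction (G⊆ w∈G) (SC-avoids-K (SC-vertices xx (p ◅◅ q) w∈))
          where
          xx : SC (Z″ s x) x x
          xx = SC-refl x∉
          pq : Walk D x x
          pq = Star.map proj₁ (p ◅◅ q)
          same : vertices pq ≡ vertices (p ◅◅ q)
          same = map-vertices proj₁ (p ◅◅ q)
          meets : G s meets vertices pq
          meets = guarded pq x∈ x∈
            (lose (subst (y ∈ˡ_) (sym same) (◅◅-vertices⁺ˡ p q (end∈ p))) y∉)
          found = find meets
          w∈ = subst (proj₁ found ∈ˡ_) same (proj₁ (proj₂ found))
          w∈G = proj₂ (proj₂ found)

        Z″≡ : ∀ {y} → SC (Z″ s x) x y → Z″ s y ≡ Z″ s x
        Z″≡ xy = cong (λ C → X s ∪ (Z s ∩ C)) (comp≡ (SC-antitone X⊆Z″ xy))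

        ∣Z″∣≤ : ∣ Z″ s x ∣ ≤ 6 * k + 1
        ∣Z″∣≤ = ≤-trans (∣p∪q∣≤∣p∣+∣q∣ (X s) _)
          (≤-trans (+-mono-≤ ∣X∣≤ (splits x∉X x∉Z)) (≤-reflexive (arith k)))
          where
          arith : ∀ k → (3 * k + 1) + 3 * k ≡ 6 * k + 1
          arith = solve-∀

      refinement : Refinement D (9 * k + 2)
      refinement = record
        { State = State ; W = W ; G = G ; K = K ; r = r
        ; next = next
        ; Inv = Inv
        ; r∈W = proj₁ ∘ r∈W∩X
        ; next∈ = λ {s} inv x∈ x≢ → ∈-step inv x∈ x≢ (nonempty? (rest s))
        ; next⊆ = λ {s} inv x∈ x≢ → step-⊆ inv x∈ x≢ (nonempty? (rest s))
        ; next≡ = λ {s} inv x∈ x≢ → step-≡ inv x∈ x≢ (nonempty? (rest s))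
        ; next-inv = λ {s} inv x∈ x≢ → step-inv inv x∈ x≢ (nonempty? (rest s))
        ; s₀ = enter ⊤ ∅
        ; s₀-inv = enter-inv (x₀ , ∈⊤) (≤-trans (≤-reflexive (∣⊥∣≡0 N)) z≤n) (λ _ → ∉⊥)
            λ p _ _ out → contradiction ∈⊤ (proj₂ (Any.satisfied out))
        ; s₀-all = λ _ → ∈⊤
        ; guards = Inv.guarded
        ; G⊆K = Inv.G⊆
        ; r∈K = λ {s} inv → q⊆p∪q (Z s) (X s) (proj₂ (r∈W∩X inv))
        ; Gnext⊆K = λ {s} inv x∈ x≢ → step-G⊆ inv x∈ x≢ (nonempty? (rest s))
        ; ∣K∣≤ = λ {s} inv → ≤-trans (∣p∪q∣≤∣p∣+∣q∣ (Z s) (X s))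
            (≤-trans (+-mono-≤ (Inv.∣Z∣≤ inv) (Inv.∣X∣≤ inv)) (≤-reflexive (arith k)))
        }
        where
        arith : ∀ k → (6 * k + 1) + (3 * k + 1) ≡ 9 * k + 2
        arith = solve-∀

        next : State → Fin N → State
        next s = step s (nonempty? (rest s))

        module _ {s x} (inv : Inv s) (x∈ : x ∈ W s) (x≢ : x ≢ r s) where

          ∈-step : ∀ d → x ∈ W (step s d x)
          ∈-step (yes _) = x∈p∧x≢y⇒x∈p-y x∈ x≢
          ∈-step (no ¬p) = ∈-comp⁺ (SC-refl (Component.x∉Z″ inv x∈ x≢ ¬p))

          step-⊆ : ∀ d {y} → y ∈ W (step s d x) → y ∈ W s × y ≢ r s
          step-⊆ (yes _) y∈ = ∈-minus⁻ (W s) y∈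
          step-⊆ (no ¬p) y∈ = SC⇒∈W xy ,
            λ { refl → SC-avoids-K xy (q⊆p∪q (Z s) (X s) (proj₂ (r∈W∩X inv))) }
            where
            open Component inv x∈ x≢ ¬p
            xy = ∈-comp⁻ y∈

          step-≡ : ∀ d {y} → y ∈ W (step s d x) → step s d y ≡ step s d x
          step-≡ (yes _) y∈ = refl
          step-≡ (no ¬p) {y} y∈ = cong₂ enter
            (trans (cong (λ Z → comp Z y) (Z″≡ xy)) (comp≡ xy)) (Z″≡ xy)
            where
            open Component inv x∈ x≢ ¬p
            xy = ∈-comp⁻ y∈

          step-inv : ∀ d → Inv (step s d x)
          step-inv (yes ne) = record
            { nonempty = ne ; ∣Z∣≤ = ∣Z∣≤ ; ∣X∣≤ = ∣X∣≤ ; splits = splits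
            ; disjoint = disjoint ∘ p─q⊆p (W s) _
            ; guarded = λ p x∈ y∈ out → guarded′ p (p─q⊆p (W s) _ x∈) (p─q⊆p (W s) _ y∈) out
            ; G⊆ = id
            }
            where
            open Inv inv
            -- A walk may leave the smaller set through `r s` without leaving `W s`; the new guard
            -- `K s` contains `r s`.
            leaves : ∀ {xs} → Any (_∉ W s - r s) xs → Any (_∉ W s) xs ⊎ K s meets xs
            leaves (here {x = w} w∉) with w ≟ r s
            ... | yes refl = inj₂ (here (q⊆p∪q (Z s) (X s) (proj₂ (r∈W∩X inv))))
            ... | no w≢    = inj₁ (here λ w∈ → w∉ (x∈p∧x≢y⇒x∈p-y w∈ w≢))
            leaves (there i) = [ inj₁ ∘ there , inj₂ ∘ there ]′ (leaves i)
            guarded′ : ∀ {x y} (p : Walk D x y) → x ∈ W s → y ∈ W s →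
              Any (_∉ W s - r s) (vertices p) → K s meets vertices p
            guarded′ p x∈ y∈ out = [ Any.map G⊆ ∘ guarded p x∈ y∈ , id ]′ (leaves out)
          step-inv (no ¬p) = enter-inv (_ , ∈-step (no ¬p)) ∣Z″∣≤
            (λ y∈ → let x∉ , p , _ = ∈-comp⁻ y∈ in avoid-end x∉ p) comp-guarded
            where open Component inv x∈ x≢ ¬p

          step-G⊆ : ∀ d → G (step s d x) ⊆ K s
          step-G⊆ (yes _) = id
          step-G⊆ (no ¬p) = Component.Z″⊆K inv x∈ x≢ ¬p

    balanced⇒width≤ : Σ (TreeDecomposition D) λ 𝒯 → TreeDecomposition.width 𝒯 ≤ 9 * k + 1
    balanced⇒width≤ = decomposition refinement ,
      ≤-trans (width≤ refinement) (≤-reflexive (cong (_∸ 1) (ℕₚ.+-suc (9 * k) 1)))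

-- Balanced separators from a branch decomposition.

unique⇒length≤ : (S : Subset n) (xs : List (Fin n)) → Unique xs → (∀ {x} → x ∈ˡ xs → x ∈ S) →
  length xs ≤ ∣ S ∣
unique⇒length≤ S []       _               _   = z≤n
unique⇒length≤ S (x ∷ xs) (new ∷ unique) xs⊆S = ≤-trans
  (s≤s (unique⇒length≤ (S - x) xs unique
    λ y∈ → x∈p∧x≢y⇒x∈p-y (xs⊆S (there y∈)) (≢-sym (All.lookup new y∈))))
  (x∈p⇒∣p-x∣<∣p∣ (xs⊆S (here refl)))

module _ (D : Digraph) where
  open StrongComponents D

  -- Some edge inside the component leaves `P`. A simple path from its head back to its tail, closed
  -- by this edge, is a cycle on both sides of `P`, and it avoids `X`.
  crossing-cycle : ∀ {X x y} {P : V D → Set} → (∀ v → Dec (P v)) → SC X x y → P x → ¬ P y →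
    Σ (Cycle D) λ C → Any P (cycleVertices C) × Any (¬_ ∘ P) (cycleVertices C) × ¬ (X meets cycleVertices C)
  crossing-cycle {X} P? (x∉ , p , q) px ¬py with crossing P? p px ¬py
  ... | a , b , x⇝a , (e , a∉ , b∉) , b⇝y , pa , ¬pb with simplify (b⇝y ◅◅ q ◅◅ x⇝a)
  ...   | r , unique , _ = C ,
      lose (subst (a ∈ˡ_) (sym same) (end∈ r)) pa ,
      lose (subst (b ∈ˡ_) (sym same) (start∈ r)) ¬pb ,
      λ meets → let w , w∈ , w∈X = find meets in
        avoid-end b∉ (proj₁ (prefix r (subst (w ∈ˡ_) same w∈))) w∈X
    where
    same : vertices (Star.map proj₁ r) ≡ vertices r
    same = map-vertices proj₁ r
    C : Cycle D
    C = record { path = Star.map proj₁ r ; closing = e ; distinct = subst Unique (sym same) unique }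

leaf-≡ : {G : Digraph} {l l′ : Leaf G} → proj₁ l ≡ proj₁ l′ → l ≡ l′
leaf-≡ {l = x , p} {.x , q} refl = cong (x ,_) (ℕₚ.≤-irrelevant p q)

module _ {D : Digraph} (ℬ : BranchDecomposition D) where
  open BranchDecomposition ℬ

  leafOf : V D → Leaf tree
  leafOf v = proj₁ (Bijection.strictlySurjective δ v)

  δ-leafOf : ∀ v → Bijection.to δ (leafOf v) ≡ v
  δ-leafOf v = proj₂ (Bijection.strictlySurjective δ v)

  leaf≡ : ∀ {x y} → proj₁ (leafOf x) ≡ proj₁ (leafOf y) → x ≡ y
  leaf≡ {x} {y} eq = trans (sym (δ-leafOf x)) (trans (cong (Bijection.to δ) (leaf-≡ {tree} eq)) (δ-leafOf y))

  opposite-sides-disjoint : ∀ {a b v} → Edge tree a b → Side a b v → ¬ Side b a v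
  opposite-sides-disjoint {a} {b} e (ℓ , p , refl) (ℓ′ , q , eq) with refl ← Bijection.injective δ eq =
    Tree.bridge undirected (loopless tree _) isTree e
      (p ◅◅ reverse (Minus-sym {R = Edge tree} undirected) (Star.map (Minus-flip {R = Edge tree}) q))

  module CentralNode (k : ℕ) (Side? : ∀ a b v → Dec (Side a b v)) where

    -- The arguments of `Side` are exchanged: these are the vertices beyond the edge to `t′` as seen
    -- from `t`.
    far : V tree → V tree → Subset (order D)
    far t t′ = subsetOf (Side? t′ t)

    module _ (Z : Subset (order D)) (small : ∣ Z ∣ ≤ 6 * k + 1) where

      Heavy : Rel (V tree) 0ℓ
      Heavy t t′ = Edge tree t t′ × 3 * k < ∣ Z ∩ far t t′ ∣

      -- The two sides of an edge are disjoint, and two shares of at least `3k + 1` do not fit into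
      -- `6k + 1`.
      heavy-one-way : ∀ {t t′} → Heavy t t′ → ¬ Heavy t′ t
      heavy-one-way {t} {t′} (e , large) (_ , large′) = ℕₚ.<⇒≱ (≤-<-trans small (≤-reflexive (arith k)))
        (≤-trans (+-mono-≤ large large′)
          (disjoint⇒∣p∣+∣q∣≤∣r∣ (Z ∩ far t t′) (Z ∩ far t′ t) Z (p∩q⊆p Z _) (p∩q⊆p Z _)
            λ v∈ v∈′ → opposite-sides-disjoint e
              (∈-subsetOf⁻ (Side? t t′) (p∩q⊆q Z _ v∈′)) (∈-subsetOf⁻ (Side? t′ t) (p∩q⊆q Z _ v∈))))
        where
        arith : ∀ k → suc (6 * k + 1) ≡ suc (3 * k) + suc (3 * k)
        arith = solve-∀

      -- Following heavy edges never turns back, so in a tree it never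
      -- revisits a node.
      module _ (heavy : ∀ t → ∃ (Heavy t)) (t₀ : V tree) where

        h : V tree → V tree
        h t = proj₁ (heavy t)

        Continues : ∀ {c z} → Star (Edge tree) c z → Set
        -- A path of one vertex has no last step to compare; `V tree` serves as a trivially true
        -- condition, with `t₀` as witness.
        Continues ε                   = V tree
        Continues {c} (_◅_ {j = d} _ _) = h d ≡ c

        long-path : ∀ j → ∃[ c ] Σ (Star (Edge tree) c t₀) λ p →
          Unique (vertices p) × length (vertices p) ≡ suc j × Continues p
        long-path zero = t₀ , ε , [] ∷ [] , refl , t₀
        long-path (suc j) with long-path j
        ... | c , p , unique , len , cont =
          h c , undirected (proj₁ (proj₂ (heavy c))) ◅ p ,
          All.tabulate (λ { w∈ refl → new p unique cont w∈ }) ∷ unique , cong suc len , refl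
          where
          c~hc : Edge tree c (h c)
          c~hc = proj₁ (proj₂ (heavy c))
          new : (p : Star (Edge tree) c t₀) → Unique (vertices p) → Continues p → h c ∉ˡ vertices p
          new ε _ _ (here eq) = loopless tree c (subst (Edge tree c) eq c~hc)
          new (e ◅ p) _ _ (here eq) = loopless tree c (subst (Edge tree c) eq c~hc)
          new (_◅_ {j = d} e p) unique hd≡c (there hc∈) with h c ≟ d
          ... | yes hc≡d = heavy-one-way
            (subst (Heavy d) hd≡c (proj₂ (heavy d))) (subst (Heavy c) hc≡d (proj₂ (heavy c)))
          ... | no hc≢d with unique | prefix p hc∈
          ...   | c∉ ∷ up | ε , _ , _ = hc≢d refl
          -- Here `h c` lies beyond `d` on the path, so the part from `c` to `h c` has at least
          -- three vertices and the edge between them closes a cycle.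
          ...   | c∉ ∷ up | q@(f ◅ q′) , q⊆p , uq = IsTree.acyclic isTree (e ◅ q) (undirected c~hc)
            (All.tabulate (All.lookup c∉ ∘ q⊆p) ∷ uq up) (s≤s (s≤s (positive q′)))

        no-escape : ⊥
        -- The path obtained has one vertex more than the tree.
        no-escape with long-path (order tree)
        ... | c , p , unique , len , _ = <-irrefl refl (≤-trans (≤-reflexive (sym len))
          (≤-trans (unique⇒length≤ ⊤ (vertices p) unique (λ _ → ∈⊤)) (∣p∣≤n {order tree} ⊤)))

      central : V tree → ∃[ t ] ∀ {t′} → Edge tree t t′ → ∣ Z ∩ far t t′ ∣ ≤ 3 * k
      central t₀ with any? (λ t → ¬? (any? (heavy? t)))
        where
        heavy? : ∀ t t′ → Dec (Heavy t t′)
        heavy? t t′ = T? _ ×-dec (3 * k <? ∣ Z ∩ far t t′ ∣)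
      ... | yes (t , light) = t , λ e → ≮⇒≥ λ large → light (_ , e , large)
      ... | no none = ⊥-elim (no-escape
        (λ t → decidable-stable (any? (λ t′ → T? _ ×-dec (3 * k <? ∣ Z ∩ far t t′ ∣)))
          (λ light → none (t , light))) t₀)

    module _ (SC? : ∀ Z x y → Dec (StrongComponents.SC D Z x y))
      (S : V tree → V tree → Subset (order D))
      (S-separates : ∀ {t t′} → Edge tree t t′ → Separates t′ t (S t t′))
      (∣S∣≤ : ∀ {t t′} → Edge tree t t′ → ∣ S t t′ ∣ ≤ k)
      (t₀ : V tree) where
      open StrongComponents D
      open BalancedSeparators D k SC?

      around : V tree → Subset (order D)
      around t = ⋃[ tabulate (edge tree t) ] (S t)

      S⊆around : ∀ {t t′} → Edge tree t t′ → S t t′ ⊆ around t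
      S⊆around {t} e = ∈-⋃[]⁺ (tabulate (edge tree t)) (S t) (∈-tabulate⁺ (edge tree t) e)

      ∣around∣≤ : ∀ t → ∣ around t ∣ ≤ 3 * k
      ∣around∣≤ t = ≤-trans
        (∣⋃[]∣≤ (tabulate (edge tree t)) (S t) (∣S∣≤ ∘ ∈-tabulate⁻ (edge tree t)))
        (ℕₚ.*-monoˡ-≤ k (subcubic t))

      -- The edge is the first one on a simple path from `t` to the leaf of `y`; the rest of the
      -- path never returns to `t`.
      leaf-side : ∀ t y → proj₁ (leafOf y) ≢ t → ∃[ t′ ] Edge tree t t′ × Side t′ t y
      leaf-side t y ≢t with simplify (IsTree.connected isTree t (proj₁ (leafOf y)))
      ... | p , unique , _ = first p unique refl
        where
        first : ∀ {u} (p : Star (Edge tree) t u) → Unique (vertices p) → u ≡ proj₁ (leafOf y) →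
          ∃[ t′ ] Edge tree t t′ × Side t′ t y
        first ε _ eq = contradiction (sym eq) ≢t
        first (e ◅ p) (t∉ ∷ _) refl = _ , e , leafOf y ,
          Star.map (Minus-flip {R = Edge tree}) (avoiding-start p λ t∈ → All.lookup t∉ t∈ refl) ,
          δ-leafOf y

      -- A component with a vertex beyond an edge at `t` lies beyond it entirely, since otherwise
      -- one of its cycles would cross the edge and avoid the separator. A component with no such
      -- vertex has only the vertex whose leaf is `t`, which is `x` and lies outside `Z`.
      around-balanced : ∀ Z t → (∀ {t′} → Edge tree t t′ → ∣ Z ∩ far t t′ ∣ ≤ 3 * k) →
        Balanced Z (around t)
      around-balanced Z t light {x} x∉X x∉Z
        with any? (λ t′ → T? (edge tree t t′) ×-dec
                          any? (λ y → (y ∈ₛ? comp (around t) x) ×-dec Side? t′ t y))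
      ... | yes (t′ , e , y , y∈ , side) = ≤-trans (p⊆q⇒∣p∣≤∣q∣ inside-far) (light e)
        where
        inside-far : Z ∩ comp (around t) x ⊆ Z ∩ far t t′
        inside-far {z} z∈ = x∈p∩q⁺ (z∈Z , ∈-subsetOf⁺ (Side? t′ t)
          (decidable-stable (Side? t′ t z) λ ¬side →
            let C , in-side , out-side , ¬meets = crossing-cycle D (Side? t′ t)
                                                    (SC-trans (SC-sym (∈-comp⁻ y∈)) (∈-comp⁻ z∈comp)) side ¬side
            in ¬meets (Any.map (S⊆around e) (S-separates e C in-side out-side))))
          where
          z∈Z = proj₁ (x∈p∩q⁻ Z _ z∈)
          z∈comp = proj₂ (x∈p∩q⁻ Z _ z∈)
      ... | no none = ≤-trans (p⊆q⇒∣p∣≤∣q∣ {q = ∅} λ {z} z∈ →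
          let z∈Z , z∈comp = x∈p∩q⁻ Z _ z∈ in
          contradiction (subst (_∈ Z) (leaf≡ (trans (at-t z∈comp) (sym (at-t (∈-comp⁺ (SC-refl x∉X)))))) z∈Z) x∉Z)
        (≤-trans (≤-reflexive (∣⊥∣≡0 (order D))) z≤n)
        where
        at-t : ∀ {y} → y ∈ comp (around t) x → proj₁ (leafOf y) ≡ t
        at-t {y} y∈ with proj₁ (leafOf y) ≟ t
        ... | yes eq = eq
        ... | no ≢t = let t′ , e , side = leaf-side t y ≢t in contradiction (t′ , e , y , y∈ , side) none

      low-width : Σ (TreeDecomposition D) λ 𝒯 → TreeDecomposition.width 𝒯 ≤ 9 * k + 1
      low-width = balanced⇒width≤ sep
        (λ Z small → sep-elim Z small (λ X → ∣ X ∣ ≤ 3 * k) λ t _ → ∣around∣≤ t)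
        (λ Z small → sep-elim Z small (Balanced Z) (around-balanced Z))
        where
        sep : Subset (order D) → Subset (order D)
        sep Z with ∣ Z ∣ ≤? 6 * k + 1
        ... | yes small = around (proj₁ (central Z small t₀))
        -- A default for sets beyond the size for which separators are requested.
        ... | no _ = ∅
        sep-elim : ∀ Z → ∣ Z ∣ ≤ 6 * k + 1 → (Q : Subset (order D) → Set) →
          (∀ t → (∀ {t′} → Edge tree t t′ → ∣ Z ∩ far t t′ ∣ ≤ 3 * k) → Q (around t)) → Q (sep Z)
        sep-elim Z small Q q with ∣ Z ∣ ≤? 6 * k + 1
        ... | yes small′ = q _ (proj₂ (central Z small′ t₀))
        ... | no large = contradiction small large

branch⇒tree : {D : Digraph} {k : ℕ} (ℬ : BranchDecomposition D) → BranchDecomposition.Width ℬ k →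
  ¬ ¬ (Σ (TreeDecomposition D) λ 𝒯 → TreeDecomposition.width 𝒯 ≤ 9 * k + 1)
branch⇒tree {D} {k} ℬ (_ , thickness≤) ¬𝒯 =
  fin-¬¬ (λ a → fin-¬¬ λ b → fin-¬¬ λ v → ¬¬-excluded-middle {A = Side a b v}) λ Side? →
  subset-¬¬ (λ Z → fin-¬¬ λ x → fin-¬¬ λ y → ¬¬-excluded-middle {A = StrongComponents.SC D Z x y}) λ SC? →
  fin-¬¬ (λ t → fin-¬¬ λ t′ → separator t t′) λ S →
  ¬𝒯 (CentralNode.low-width ℬ k Side? SC? (λ t t′ → proj₁ (S t t′))
       (λ {t} {t′} e → proj₁ (proj₂ (S t t′) e)) (λ {t} {t′} e → proj₂ (proj₂ (S t t′) e))
       (some (order tree) {{Digraph.nonEmpty tree}}))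
  where
  open BranchDecomposition ℬ
  separator : ∀ t t′ → ¬ ¬ (∃[ S ] (Edge tree t t′ → Separates t′ t S × ∣ S ∣ ≤ k))
  separator t t′ ¬S with T? (edge tree t t′)
  ... | no ¬e = ¬S (∅ , λ e → contradiction e ¬e)
  -- The set of all vertices separates, so a least separator exists; its size is a thickness and
  -- hence bounded by the width.
  ... | yes e = least-¬¬ {λ j → ∃[ S ] Separates t′ t S × ∣ S ∣ ≡ j} ∣ ⊤ {order D} ∣ (⊤ , (λ C in-side _ → Any.map (λ _ → ∈⊤) in-side) , refl)
    λ (j , thick@((S , sep , ∣S∣≡j) , _)) → ¬S (S , λ _ →
      sep , ≤-trans (≤-reflexive ∣S∣≡j) (thickness≤ (inj₂ (t′ , t , undirected e , thick))))

-- Arborescences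

module ArborescenceProperties {A : Digraph} (isArb : IsArborescence A) where
  open IsArborescence isArb

  ρ : V A
  ρ = proj₁ root

  ρ-reaches : ∀ t → Walk A ρ t
  ρ-reaches = proj₁ (proj₂ root)

  -- A simple walk back would make the edge a loop, one of two opposite edges, or part of an
  -- undirected cycle.
  no-return : ∀ {d t} → Edge A d t → ¬ Walk A t d
  no-return {d} {t} e w with simplify w
  ... | p , unique , _ = shape p unique
    where
    shape : (p : Walk A t d) → Unique (vertices p) → ⊥
    shape ε _ = loopless A _ e
    shape (e′ ◅ ε) _ = oriented e e′
    shape p@(_ ◅ _ ◅ q) unique = IsTree.acyclic underlying (Star.map fwd p) (fwd e)
      (subst Unique (sym (map-vertices {R = Edge A} fwd p)) unique)
      (subst (λ xs → 3 ≤ length xs) (sym (map-vertices {R = Edge A} fwd p)) (s≤s (s≤s (positive q))))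

  ρ-parentless : ∀ {d} → ¬ Edge A d ρ
  ρ-parentless e = no-return e (ρ-reaches _)

  has-parent : ∀ {t} → t ≢ ρ → ∃[ d ] Edge A d t
  has-parent {t} t≢ = last-edge (ρ-reaches t) t≢
    where
    last-edge : ∀ {x} → Walk A x t → t ≢ x → ∃[ d ] Edge A d t
    last-edge ε t≢ = contradiction refl t≢
    last-edge (_◅_ {j = y} e p) _ with t ≟ y
    ... | yes refl = _ , e
    ... | no t≢y   = last-edge p t≢y

  -- Both parents are reached from the root by walks avoiding `t`. Joined at the root, these give an
  -- undirected path between distinct parents that `t` would close to a cycle.
  parent-unique : ∀ {d d′ t} → Edge A d t → Edge A d′ t → d ≡ d′
  parent-unique {d} {d′} {t} e e′ with d ≟ d′
  ... | yes eq = eq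
  ... | no d≢d′ with simplify (reverse Off-sym (off e (ρ-reaches d)) ◅◅ off e′ (ρ-reaches d′))
    where
    Off : Rel (V A) 0ℓ
    Off u v = SymClosure (Edge A) u v × u ≢ t × v ≢ t
    Off-sym : Symmetric Off
    Off-sym (fwd e , u≢ , v≢) = bwd e , v≢ , u≢
    Off-sym (bwd e , u≢ , v≢) = fwd e , v≢ , u≢
    off : ∀ {x d} → Edge A d t → Walk A x d → Star Off x d
    off e ε = ε
    off e (f ◅ p) = (fwd f , (λ { refl → no-return e (f ◅ p) }) , λ { refl → no-return e p }) ◅ off e p
  ...   | ε , _ = contradiction refl d≢d′
  ...   | p@((_ , d≢t , _) ◅ q) , unique , _ = ⊥-elim
    (IsTree.acyclic underlying (bwd e ◅ Star.map proj₁ p) (fwd e′)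
      (All.tabulate (λ {w} w∈ t≡w → off-t p (subst (w ∈ˡ_) (map-vertices proj₁ p) w∈) d≢t (sym t≡w))
        ∷ subst Unique (sym (map-vertices proj₁ p)) unique)
      (s≤s (s≤s (positive (Star.map proj₁ q)))))
    where
    off-t : ∀ {x y w} (p : Star (λ u v → SymClosure (Edge A) u v × u ≢ t × v ≢ t) x y) →
      w ∈ˡ vertices p → x ≢ t → w ≢ t
    off-t ε                  (here refl) x≢ = x≢
    off-t (_ ◅ _)            (here refl) x≢ = x≢
    off-t ((_ , _ , y≢) ◅ p) (there w∈)  _  = off-t p w∈ y≢

  module Depth (walk? : ∀ t t′ → Dec (Walk A t t′)) where

    -- The number of nodes not reachable from `t`; what is required of it is strict growth along
    -- edges, not the distance from the root.
    depth : V A → ℕ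
    depth t = order A ∸ ∣ subsetOf (walk? t) ∣

    depth-< : ∀ {d t} → Edge A d t → depth d < depth t
    depth-< {d} {t} e = ℕₚ.∸-monoʳ-<
      (p⊂q⇒∣p∣<∣q∣
        ( (λ t′∈ → ∈-subsetOf⁺ (walk? d) (e ◅ ∈-subsetOf⁻ (walk? t) t′∈))
        , d , ∈-subsetOf⁺ (walk? d) ε , no-return e ∘ ∈-subsetOf⁻ (walk? t)))
      (∣p∣≤n (subsetOf (walk? d)))

-- Immediate predecessors among the indices satisfying a predicate.

module _ (P : Fin n → Set) (b : ℕ) where

  NoneBelow : Set
  NoneBelow = ∀ {j} → P j → ¬ toℕ j < b

  record Largest (i : Fin n) : Set where
    field
      holds   : P i
      below   : toℕ i < b
      largest : ∀ {j} → P j → toℕ j < b → toℕ j ≤ toℕ i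

largest? : {P : Fin n → Set} → (∀ i → Dec (P i)) → ∀ b → ∃ (Largest P b) ⊎ NoneBelow P b
largest? P? zero = inj₂ λ _ ()
largest? P? (suc b) with any? (λ i → (toℕ i ℕₚ.≟ b) ×-dec P? i)
... | yes (i , refl , p) = inj₁ (i , record { holds = p ; below = ≤-refl ; largest = λ _ → ℕₚ.≤-pred })
... | no none with largest? P? b
...   | inj₁ (i , l) = inj₁ (i , record
  { holds = holds ; below = ℕₚ.m<n⇒m<1+n below
  ; largest = λ {j} p j< → largest p (ℕₚ.≤∧≢⇒< (ℕₚ.≤-pred j<) λ eq → none (j , eq , p)) })
  where open Largest l
...   | inj₂ none′ = inj₂ λ {j} p j< → none′ p (ℕₚ.≤∧≢⇒< (ℕₚ.≤-pred j<) λ eq → none (j , eq , p))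

-- Of two distinct elements with the same predecessor, the smaller would be a later predecessor of
-- the larger.
largest-injective : {P : Fin n → Set} {v w j : Fin n} → P v → P w →
  Largest P (toℕ v) j → Largest P (toℕ w) j → v ≡ w
largest-injective {v = v} {w} pv pw lv lw with ℕₚ.<-cmp (toℕ v) (toℕ w)
... | tri< v<w _ _ = contradiction (Largest.largest lw pv v<w) (ℕₚ.<⇒≱ (Largest.below lv))
... | tri≈ _ eq _  = toℕ-injective eq
... | tri> _ _ w<v = contradiction (Largest.largest lv pw w<v) (ℕₚ.<⇒≱ (Largest.below lw))

none-injective : {P : Fin n → Set} {v w : Fin n} → P v → P w →
  NoneBelow P (toℕ v) → NoneBelow P (toℕ w) → v ≡ w
none-injective {v = v} {w} pv pw nv nw with ℕₚ.<-cmp (toℕ v) (toℕ w)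
... | tri< v<w _ _ = contradiction v<w (nw pv)
... | tri≈ _ eq _  = toℕ-injective eq
... | tri> _ _ w<v = contradiction w<v (nv pw)

-- Guards speak of walks with both ends in the subtree, so the cycle is rotated to `x`. A full extra
-- turn in the middle visits `y` whether it comes before or after `x`.
cycle⇒closed-walk : ∀ {D} (C : Cycle D) {x y} → x ∈ˡ cycleVertices C → y ∈ˡ cycleVertices C →
  Σ (Walk D x x) λ p → y ∈ˡ vertices p × vertices p ⊆ˡ cycleVertices C
cycle⇒closed-walk {D} C {x} {y} x∈ y∈ with suffix (Cycle.path C) x∈ | prefix (Cycle.path C) x∈
... | s , s⊆ , _ | q , q⊆ , _ = s ◅◅ loop ,
    ◅◅-vertices⁺ʳ s loop (there (◅◅-vertices⁺ʳ ε (path ◅◅ closing ◅ q) (◅◅-vertices⁺ˡ path _ y∈))) ,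
    [ s⊆ , [ s⊆ ∘ (λ { (here refl) → end∈ s }) , [ id , [ (λ { (here refl) → end∈ path }) , q⊆ ]′ ∘ uncons ]′ ∘ ◅◅-vertices⁻ path (closing ◅ q) ]′ ∘ uncons ]′ ∘ ◅◅-vertices⁻ s loop
  where
  open Cycle C using (path; closing)
  loop : Walk D (Cycle.end C) x
  loop = closing ◅ path ◅◅ closing ◅ q
  uncons : ∀ {z v : V D} {xs} → v ∈ˡ z ∷ xs → v ∈ˡ z ∷ [] ⊎ v ∈ˡ xs
  uncons (here eq) = inj₁ (here eq)
  uncons (there i) = inj₂ i

-- The branch decomposition built from a tree decomposition.

module BranchFromTree {D : Digraph} (𝒯 : TreeDecomposition D)
  (walk? : ∀ t t′ → Dec (Walk (TreeDecomposition.tree 𝒯) t t′))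
  (other : (v : V D) → ∃[ x ] x ≢ v) where
  open TreeDecomposition 𝒯 renaming (tree to A)
  open ArborescenceProperties isArborescence
  open Depth walk?

  private
    n₀ = order D
    m₀ = order A

  bag : V D → V A
  bag v = proj₁ (β-partition v)

  v∈bag : ∀ v → v ∈ β (bag v)
  v∈bag v = proj₁ (proj₂ (β-partition v))

  bag-unique : ∀ {v t} → v ∈ β t → bag v ≡ t
  bag-unique {v} = proj₂ (proj₂ (β-partition v))

  -- ℓ v is the leaf of v. The vertices of a bag t form a descending chain of
  -- nodes σ v, each with ℓ v attached, below κ t; the nodes κ c for the
  -- children c of t continue this chain, with the subtree of c attached to κ c.
  data Node : Set where
    ℓ σ : V D → Node
    κ   : V A → Node

  ℓ-injective : ∀ {u w} → ℓ u ≡ ℓ w → u ≡ w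
  ℓ-injective refl = refl

  InBag : V A → V D → Set
  InBag t v = bag v ≡ t

  -- As the root, κ ρ would have only one neighbour; it therefore takes over
  -- the leaf of the first vertex of its bag.
  Special : V D → Set
  Special v = bag v ≡ ρ × NoneBelow (InBag ρ) (toℕ v)

  -- The label tells the children of a node apart, which bounds the degree.
  data Parent : Node → Node → Bool → Set where
    σσ : ∀ {v j} → Largest (InBag (bag v)) (toℕ v) j → Parent (σ v) (σ j) false
    σκ : ∀ {v t} → bag v ≡ t → NoneBelow (InBag t) (toℕ v) → Parent (σ v) (κ t) true
    κκ : ∀ {d c j} → Edge A d c → Largest (Edge A d) (toℕ c) j → Parent (κ c) (κ j) false
    κσ : ∀ {d c j} → Edge A d c → NoneBelow (Edge A d) (toℕ c) → Largest (InBag d) n₀ j →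
         Parent (κ c) (σ j) false
    ℓσ : ∀ {v} → ¬ Special v → Parent (ℓ v) (σ v) true
    ℓκ : ∀ {v} → Special v → Parent (ℓ v) (κ ρ) false

  special? : ∀ v → Dec (Special v)
  special? v with bag v ≟ ρ
  ... | no ≢ρ = no (≢ρ ∘ proj₁)
  ... | yes eq with largest? (λ j → bag j ≟ ρ) (toℕ v)
  ...   | inj₁ (j , l) = no λ (_ , none) → none (Largest.holds l) (Largest.below l)
  ...   | inj₂ none    = yes (eq , none)

  special-unique : ∀ {v w} → Special v → Special w → v ≡ w
  special-unique (v∈ , nv) (w∈ , nw) = none-injective v∈ w∈ nv nw

  parent : ∀ a → a ≢ κ ρ → ∃[ b ] ∃[ l ] Parent a b l
  parent (ℓ v) _ with special? v
  ... | yes sp = _ , _ , ℓκ sp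
  ... | no ¬sp = _ , _ , ℓσ ¬sp
  parent (σ v) _ with largest? (λ j → bag j ≟ bag v) (toℕ v)
  ... | inj₁ (_ , l) = _ , _ , σσ l
  ... | inj₂ none    = _ , _ , σκ refl none
  parent (κ c) c≢ with has-parent (λ { refl → c≢ refl })
  ... | d , e with largest? (λ j → T? (edge A d j)) (toℕ c)
  ...   | inj₁ (_ , l) = _ , _ , κκ e l
  ...   | inj₂ none with largest? (λ j → bag j ≟ d) n₀
  ...     | inj₁ (_ , l) = _ , _ , κσ e none l
  -- Bags are nonempty, so the chain of `d` has a last vertex to which the children can be attached.
  ...     | inj₂ empty   = contradiction (toℕ<n (proj₁ (β-nonempty d))) (empty (bag-unique (proj₂ (β-nonempty d))))

  -- Ensures that the child of `σ j` labelled `false` is either the next vertex of the bag or the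
  -- first child subtree, never both.
  σ-not-last : ∀ {v j d} → Largest (InBag (bag v)) (toℕ v) j → ¬ Largest (InBag d) n₀ j
  σ-not-last {v} {j} l last = ℕₚ.<⇒≱ (Largest.below l)
    (Largest.largest last (trans (sym (Largest.holds l)) (Largest.holds last)) (toℕ<n v))

  parent-injective : ∀ {a a′ b l} → Parent a b l → Parent a′ b l → a ≡ a′
  parent-injective (σσ {v} {j} p) (σσ {w} q) = cong σ
    (largest-injective refl bag≡ p (subst (λ t → Largest (InBag t) (toℕ w) j) bag≡ q))
    where
    bag≡ : bag w ≡ bag v
    bag≡ = trans (sym (Largest.holds q)) (Largest.holds p)
  parent-injective (σσ p) (κσ _ _ q) = ⊥-elim (σ-not-last p q)
  parent-injective (κσ _ _ p) (σσ q) = ⊥-elim (σ-not-last q p)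
  parent-injective (σκ p np) (σκ q nq) = cong σ (none-injective p q np nq)
  parent-injective (κκ e p) (κκ f q) with refl ← parent-unique (Largest.holds p) (Largest.holds q) =
    cong κ (largest-injective e f p q)
  parent-injective (κκ _ p) (ℓκ _) = contradiction (Largest.holds p) ρ-parentless
  parent-injective (ℓκ _) (κκ _ q) = contradiction (Largest.holds q) ρ-parentless
  parent-injective (κσ e np p) (κσ f nq q) with refl ← trans (sym (Largest.holds p)) (Largest.holds q) =
    cong κ (none-injective e f np nq)
  parent-injective (ℓσ _) (ℓσ _) = refl
  parent-injective (ℓκ p) (ℓκ q) = cong ℓ (special-unique p q)

  -- The rank orders nodes lexicographically by depth and then along chains.
  private
    base : V A → ℕ
    base t = depth t * suc (n₀ + m₀)

  nodeRank : Node → ℕ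
  nodeRank (σ v) = base (bag v) + suc (toℕ v)
  nodeRank (ℓ v) = suc (base (bag v) + suc (toℕ v))
  nodeRank (κ c) with c ≟ ρ
  ... | yes _ = 0
  ... | no c≢ = base (proj₁ (has-parent c≢)) + suc (n₀ + toℕ c)

  rank-κ : ∀ {d c} → Edge A d c → nodeRank (κ c) ≡ base d + suc (n₀ + toℕ c)
  rank-κ {c = c} e with c ≟ ρ
  ... | yes refl = contradiction e ρ-parentless
  ... | no c≢ = cong (λ d → base d + suc (n₀ + toℕ c)) (parent-unique (proj₂ (has-parent c≢)) e)

  -- `κ t` is ranked in the block of the parent of `t`, after the `n₀` places for vertices. A block
  -- has `n₀ + m₀ + 1` places and thus ends before the block of the deeper node `t` begins.
  rank-κ< : ∀ t → nodeRank (κ t) < suc (base t)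
  rank-κ< t with t ≟ ρ
  ... | yes _ = s≤s z≤n
  ... | no t≢ = s≤s (begin
    base d + suc (n₀ + toℕ t)   ≤⟨ ℕₚ.+-monoʳ-≤ (base d) (s≤s (ℕₚ.+-monoʳ-≤ n₀ (ℕₚ.<⇒≤ (toℕ<n t)))) ⟩
    base d + suc (n₀ + m₀)      ≡⟨ ℕₚ.+-comm (base d) _ ⟩
    suc (depth d) * suc (n₀ + m₀) ≤⟨ ℕₚ.*-monoˡ-≤ (suc (n₀ + m₀)) (depth-< e) ⟩
    base t                      ∎)
    where
    open ℕₚ.≤-Reasoning
    d = proj₁ (has-parent t≢)
    e = proj₂ (has-parent t≢)

  rank-κ<σ : ∀ v → nodeRank (κ (bag v)) < nodeRank (σ v)
  rank-κ<σ v = <-≤-trans (rank-κ< (bag v))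
    (≤-trans (≤-reflexive (ℕₚ.+-comm 1 _)) (ℕₚ.+-monoʳ-≤ (base (bag v)) (s≤s z≤n)))

  parent-rank : ∀ {a b l} → Parent a b l → nodeRank b < nodeRank a
  parent-rank (σσ {v} {j} l) = subst (λ t → base t + suc (toℕ j) < base (bag v) + suc (toℕ v))
    (sym (Largest.holds l)) (ℕₚ.+-monoʳ-< (base (bag v)) (s≤s (Largest.below l)))
  parent-rank (σκ {v} refl _) = rank-κ<σ v
  parent-rank (κκ {d} e l) = subst₂ _<_ (sym (rank-κ (Largest.holds l))) (sym (rank-κ e))
    (ℕₚ.+-monoʳ-< (base d) (s≤s (ℕₚ.+-monoʳ-< n₀ (Largest.below l))))
  parent-rank (κσ {d} {c} {j} e _ l) = subst₂ _<_
    (cong (λ t → base t + suc (toℕ j)) (sym (Largest.holds l))) (sym (rank-κ e))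
    (ℕₚ.+-monoʳ-< (base d) (s≤s (<-≤-trans (toℕ<n j) (m≤m+n n₀ (toℕ c)))))
  parent-rank (ℓσ _) = ≤-refl
  parent-rank (ℓκ {v} (v∈ , _)) =
    subst (λ t → nodeRank (κ t) < nodeRank (ℓ v)) v∈ (ℕₚ.m<n⇒m<1+n (rank-κ<σ v))

  N : ℕ
  N = n₀ + (n₀ + m₀)

  abstract
    enc : Node → Fin N
    enc (ℓ v) = join n₀ _ (inj₁ v)
    enc (σ v) = join n₀ _ (inj₂ (join n₀ m₀ (inj₁ v)))
    enc (κ t) = join n₀ _ (inj₂ (join n₀ m₀ (inj₂ t)))

    dec₂ : V D ⊎ V A → Node
    dec₂ (inj₁ v) = σ v
    dec₂ (inj₂ t) = κ t

    dec₁ : V D ⊎ Fin (n₀ + m₀) → Node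
    dec₁ (inj₁ v) = ℓ v
    dec₁ (inj₂ i) = dec₂ (splitAt n₀ i)

    dec : Fin N → Node
    dec i = dec₁ (splitAt n₀ i)

    dec-enc : ∀ a → dec (enc a) ≡ a
    dec-enc (ℓ v) = cong dec₁ (splitAt-join n₀ _ (inj₁ v))
    dec-enc (σ v) = trans (cong dec₁ (splitAt-join n₀ _ (inj₂ (join n₀ m₀ (inj₁ v)))))
                          (cong dec₂ (splitAt-join n₀ m₀ (inj₁ v)))
    dec-enc (κ t) = trans (cong dec₁ (splitAt-join n₀ _ (inj₂ (join n₀ m₀ (inj₂ t)))))
                          (cong dec₂ (splitAt-join n₀ m₀ (inj₂ t)))

    enc-dec : ∀ i → enc (dec i) ≡ i
    enc-dec i = trans (outer (splitAt n₀ i)) (join-splitAt n₀ _ i)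
      where
      inner : ∀ s → enc (dec₂ s) ≡ join n₀ _ (inj₂ (join n₀ m₀ s))
      inner (inj₁ v) = refl
      inner (inj₂ t) = refl
      outer : ∀ s → enc (dec₁ s) ≡ join n₀ _ s
      outer (inj₁ v) = refl
      outer (inj₂ i) = trans (inner (splitAt n₀ i)) (cong (join n₀ _ ∘ inj₂) (join-splitAt n₀ m₀ i))

  enc-injective : ∀ {a b} → enc a ≡ enc b → a ≡ b
  enc-injective {a} {b} eq = trans (sym (dec-enc a)) (trans (cong dec eq) (dec-enc b))

  root-node : Fin N
  root-node = enc (κ ρ)

  dec-root : ∀ {x} → x ≢ root-node → dec x ≢ κ ρ
  dec-root x≢ eq = x≢ (trans (sym (enc-dec _)) (cong enc eq))

  abstract
    par : Fin N → Fin N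
    par x with x ≟ root-node
    ... | yes _ = x
    ... | no x≢ = enc (proj₁ (parent (dec x) (dec-root x≢)))

    label : Fin N → Bool
    label x with x ≟ root-node
    ... | yes _ = false
    ... | no x≢ = proj₁ (proj₂ (parent (dec x) (dec-root x≢)))

    par-parent : ∀ {x} → x ≢ root-node → Parent (dec x) (dec (par x)) (label x)
    par-parent {x} x≢ with x ≟ root-node
    ... | yes eq = contradiction eq x≢
    ... | no x≢′ = subst (λ b → Parent (dec x) b (proj₁ (proj₂ (parent (dec x) (dec-root x≢′))))) (sym (dec-enc _)) (proj₂ (proj₂ (parent (dec x) (dec-root x≢′))))

  open Rooted root-node par (nodeRank ∘ dec) (parent-rank ∘ par-parent)

  up-parent : ∀ {x y} → Up x y → Parent (dec x) (dec y) (label x)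
  up-parent (x≢ , refl) = par-parent x≢

  up-injective : ∀ {x y z} → Up x z → Up y z → label x ≡ label y → x ≡ y
  up-injective {x} {y} u w eq = trans (sym (enc-dec x)) (trans (cong enc
    (parent-injective (up-parent u) (subst (Parent (dec y) _) (sym eq) (up-parent w)))) (enc-dec y))

  graph : Digraph
  graph .Digraph.order = N
  graph .Digraph.nonEmpty = fin-nonzero root-node
    where
    fin-nonzero : ∀ {n} → Fin n → NonZero n
    fin-nonzero {suc _} _ = _
  graph .Digraph.edge x y = does (up? x y ⊎-dec up? y x)
  graph .Digraph.loopless x e with T-does (up? x x ⊎-dec up? x x) e
  ... | inj₁ (x≢ , eq) = par⋢ x≢ (subst (_⊑ x) (sym eq) ε)
  ... | inj₂ (x≢ , eq) = par⋢ x≢ (subst (_⊑ x) (sym eq) ε)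

  edge⁻ : ∀ {x y} → Edge graph x y → Up x y ⊎ Up y x
  edge⁻ {x} {y} = T-does (up? x y ⊎-dec up? y x)

  edge⁺ : ∀ {x y} → Up x y ⊎ Up y x → Edge graph x y
  edge⁺ {x} {y} = does-T (up? x y ⊎-dec up? y x)

  graph-sym : Symmetric (Edge graph)
  graph-sym {x} {y} = edge⁺ {y} {x} ∘ swap ∘ edge⁻ {x} {y}

  graph-isTree : IsTree (Edge graph)
  graph-isTree = isTree (λ {x} {y} → edge⁻ {x} {y})
    λ {x} {y} u → edge⁺ {x} {y} (inj₁ u) , edge⁺ {y} {x} (inj₂ u)

  up-asym : ∀ {x y} → Up x y → ¬ Up y x
  up-asym (x≢ , refl) u = par⋢ x≢ (u ◅ ε)

  module _ (x : Fin N) where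

    neighbours : Subset N
    neighbours = tabulate (edge graph x)

    neighbour⁻ : ∀ {y} → y ∈ neighbours → Up x y ⊎ Up y x
    neighbour⁻ {y} y∈ = edge⁻ {x} {y} (∈-tabulate⁻ (edge graph x) y∈)

    neighbour⁺ : ∀ {y} → Up x y ⊎ Up y x → y ∈ neighbours
    neighbour⁺ {y} u = ∈-tabulate⁺ (edge graph x) (edge⁺ {x} {y} u)

    -- Three slots suffice: one for the parent and one for each label of a child.
    degree≤3 : ∣ neighbours ∣ ≤ 3
    degree≤3 = card-≤ neighbours (λ y y∈ → slot (neighbour⁻ y∈))
      λ y∈ z∈ → slot-injective (neighbour⁻ y∈) (neighbour⁻ z∈)
      where
      child-slot : Bool → Fin 3
      child-slot false = suc zero
      child-slot true  = suc (suc zero)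
      child-slot-injective : ∀ a b → child-slot a ≡ child-slot b → a ≡ b
      child-slot-injective false false _ = refl
      child-slot-injective true  true  _ = refl
      slot : ∀ {y} → Up x y ⊎ Up y x → Fin 3
      slot (inj₁ _)     = zero
      slot {y} (inj₂ _) = child-slot (label y)
      child≢parent : ∀ b → child-slot b ≢ zero
      child≢parent false ()
      child≢parent true ()
      slot-injective : ∀ {y z} (u : Up x y ⊎ Up y x) (w : Up x z ⊎ Up z x) → slot u ≡ slot w → y ≡ z
      slot-injective (inj₁ (_ , refl)) (inj₁ (_ , refl)) _ = refl
      slot-injective {z = z} (inj₁ _) (inj₂ _) eq = contradiction (sym eq) (child≢parent (label z))
      slot-injective {y} (inj₂ _) (inj₁ _) eq = contradiction eq (child≢parent (label y))
      slot-injective (inj₂ u) (inj₂ w) eq = up-injective u w (child-slot-injective _ _ eq)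

    two-neighbours : ∀ {y z} → Up x y ⊎ Up y x → Up x z ⊎ Up z x → y ≢ z → ¬ ∣ neighbours ∣ ≤ 1
    two-neighbours u w = two-elements neighbours (neighbour⁺ u) (neighbour⁺ w)

  infix 4 _⊴_
  _⊴_ : Rel Node 0ℓ
  a ⊴ b = enc a ⊑ enc b

  ⊑-⊴ : ∀ {x y} → x ⊑ y → dec x ⊴ dec y
  ⊑-⊴ = subst₂ _⊑_ (sym (enc-dec _)) (sym (enc-dec _))


  private
    -- Every node lies below the head of its chain, where `κ c` counts as a member of the chain of
    -- the parent of `c`.
    Reaches : Node → Set
    Reaches (ℓ v) = ℓ v ⊴ κ (bag v)
    Reaches (σ v) = σ v ⊴ κ (bag v)
    Reaches (κ c) = ∀ {d} → Edge A d c → κ c ⊴ κ d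

  reaches-κ : ∀ a → Reaches a
  reaches-κ a = subst Reaches (dec-enc a) (climb (⊑-root (enc a)))
    where
    step : ∀ {a b l} → Parent a b l → a ⊴ b → Reaches b → Reaches a
    step (σσ {v} {j} l) a⊴b r = a⊴b ◅◅ subst (λ t → σ j ⊴ κ t) (Largest.holds l) r
    step (σκ refl _) a⊴b _ = a⊴b
    step (κκ e l) a⊴b r f with refl ← parent-unique e f = a⊴b ◅◅ r (Largest.holds l)
    step (κσ {j = j} e _ l) a⊴b r f with refl ← parent-unique e f =
      a⊴b ◅◅ subst (λ t → σ j ⊴ κ t) (Largest.holds l) r
    step (ℓσ _) a⊴b r = a⊴b ◅◅ r
    step (ℓκ {v} (v∈ , _)) a⊴b _ = subst (λ t → ℓ v ⊴ κ t) (sym v∈) a⊴b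
    climb : ∀ {x} → x ⊑ root-node → Reaches (dec x)
    climb ε       = subst Reaches (sym (dec-enc (κ ρ))) λ e → contradiction e ρ-parentless
    climb (u ◅ p) = step (up-parent u) (⊑-⊴ (u ◅ ε)) (climb p)

  below⇒⊴ : ∀ {c v} → Below c v → ℓ v ⊴ κ c
  below⇒⊴ {c} {v} (t , walk , v∈) =
    subst (λ t → ℓ v ⊴ κ t) (bag-unique v∈) (reaches-κ (ℓ v)) ◅◅ descend walk
    where
    descend : ∀ {c} → Walk A c t → κ t ⊴ κ c
    descend ε       = ε
    descend (e ◅ w) = descend w ◅◅ reaches-κ (κ _) e

  -- The node of 𝒯 whose Γ separates what lies below a from the rest.
  τ : Node → V A
  τ (ℓ v) = bag v
  τ (σ v) = bag v
  τ (κ c) with c ≟ ρ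
  ... | yes _ = ρ
  ... | no c≢ = proj₁ (has-parent c≢)

  τ-κ : ∀ {d c} → Edge A d c → τ (κ c) ≡ d
  τ-κ {c = c} e with c ≟ ρ
  ... | yes refl = contradiction e ρ-parentless
  ... | no c≢ = parent-unique (proj₂ (has-parent c≢)) e

  -- What lies below `a` consists of vertices in the bag of `τ a` and of whole subtrees of children
  -- of `τ a`; this form lets the guards of those children act.
  Captured : V D → Node → Set
  Captured v a = v ∈ β (τ a) ⊎ (∃[ c ] Edge A (τ a) c × κ c ⊴ a × Below c v)

  captured : ∀ {v a} → ℓ v ⊴ a → a ≢ κ ρ → Captured v a
  captured {v} {a} p a≢ = subst (Captured v) (dec-enc a)
    (climb p (a≢ ∘ enc-injective) (subst (Captured v) (sym (dec-enc (ℓ v))) (inj₁ (v∈bag v))))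
    where
    same-τ : ∀ {a b} → τ a ≡ τ b → a ⊴ b → Captured v a → Captured v b
    same-τ τ≡ a⊴b (inj₁ v∈) = inj₁ (subst (λ t → v ∈ β t) τ≡ v∈)
    same-τ τ≡ a⊴b (inj₂ (c , e , c⊴a , below)) =
      inj₂ (c , subst (λ t → Edge A t c) τ≡ e , c⊴a ◅◅ a⊴b , below)
    step : ∀ {a b l} → Parent a b l → a ⊴ b → b ≢ κ ρ → Captured v a → Captured v b
    step {a} {b} (σσ l) a⊴b _ = same-τ {a} {b} (sym (Largest.holds l)) a⊴b
    -- Passing from the first vertex of the bag to `κ t` moves `τ` up to the parent of `t`, and
    -- everything captured so far becomes part of the single child subtree at `t`.
    step {b = κ t} (σκ refl _) a⊴b b≢ q with has-parent (λ { refl → b≢ refl })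
    ... | d , e = inj₂ (t , subst (λ d → Edge A d t) (sym (τ-κ e)) e , ε , below q)
      where
      below : ∀ {w} → Captured v (σ w) → Below (bag w) v
      below (inj₁ v∈)                            = _ , ε , v∈
      below (inj₂ (_ , f , _ , t′ , walk , v∈)) = t′ , f ◅ walk , v∈
    step {a} {b} (κκ e l) a⊴b _ = same-τ {a} {b} (trans (τ-κ e) (sym (τ-κ (Largest.holds l)))) a⊴b
    step {a} {b} (κσ e _ l) a⊴b _ = same-τ {a} {b} (trans (τ-κ e) (sym (Largest.holds l))) a⊴b
    step {a} {b} (ℓσ _) a⊴b _ = same-τ {a} {b} refl a⊴b
    step (ℓκ _) _ b≢ _ = contradiction refl b≢
    climb : ∀ {x y} → x ⊑ y → y ≢ root-node → Captured v (dec x) → Captured v (dec y)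
    climb ε _ q = q
    climb (u ◅ p) y≢ q = climb p y≢ (step (up-parent u) (⊑-⊴ (u ◅ ε)) (dec-root (not-root p)) q)
      where
      not-root : ∀ {z} → z ⊑ _ → z ≢ root-node
      not-root ε              = y≢
      not-root ((z≢ , _) ◅ _) = z≢

  -- In the second case `κ c` lies below `x`, so `w` is not below `c` and the walk around the cycle
  -- from `u` leaves the subtree of `c`.
  Γ-separates : ∀ {x} → x ≢ root-node → (C : Cycle D) → ∀ {u w} →
    u ∈ˡ cycleVertices C → w ∈ˡ cycleVertices C → enc (ℓ u) ⊑ x → ¬ enc (ℓ w) ⊑ x →
    Γ (τ (dec x)) meets cycleVertices C
  Γ-separates {x} x≢ C {u} {w} u∈ w∈ u⊑x w⋢x
    with captured {u} {dec x} (subst (enc (ℓ u) ⊑_) (sym (enc-dec x)) u⊑x) (dec-root x≢)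
  ... | inj₁ u∈β = lose u∈ (β⊆Γ 𝒯 (τ (dec x)) u∈β)
  ... | inj₂ (c , e , c⊴ , below) =
    let p , w∈p , p⊆C = cycle⇒closed-walk C u∈ w∈
        z , z∈ , z∈γ = find (γ-guards e p below below (lose w∈p λ w-below →
          w⋢x (below⇒⊴ w-below ◅◅ subst (enc (κ c) ⊑_) (enc-dec x) c⊴)))
    in lose (p⊆C z∈) (γ⊆Γ 𝒯 (τ (dec x)) c e z∈γ)

  child-towards : ∀ {x y} → x ⊑ y → x ≢ y → ∃[ b ] x ⊑ b × Up b y
  child-towards ε       x≢ = contradiction refl x≢
  child-towards (u ◅ p) _  = last-step u p

  childless-ℓ : ∀ {x v} → ¬ Up x (enc (ℓ v))
  childless-ℓ {x} {v} u with subst (λ b → Parent (dec x) b (label x)) (dec-enc (ℓ v)) (up-parent u)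
  ... | ()

  ⊑-ℓ : ∀ {x v} → x ⊑ enc (ℓ v) → x ≡ enc (ℓ v)
  ⊑-ℓ ε = refl
  ⊑-ℓ {v = v} (u ◅ p) = contradiction (proj₂ (proj₂ (last-step u p))) (childless-ℓ {v = v})

  up-to : ∀ {a b} → a ≢ κ ρ → (∀ {b′ l} → Parent a b′ l → b′ ≡ b) → Up (enc a) (enc b)
  up-to {a} {b} a≢ only = a≢ ∘ enc-injective , trans (sym (enc-dec (par (enc a)))) (cong enc
    (only (subst (λ a′ → Parent a′ (dec (par (enc a))) (label (enc a))) (dec-enc a)
      (par-parent (a≢ ∘ enc-injective)))))

  ℓ-up-σ : ∀ {v} → ¬ Special v → Up (enc (ℓ v)) (enc (σ v))
  ℓ-up-σ ¬sp = up-to (λ ()) λ { (ℓσ _) → refl ; (ℓκ sp) → contradiction sp ¬sp }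

  ℓ-up-root : ∀ {v} → Special v → Up (enc (ℓ v)) root-node
  ℓ-up-root sp = up-to (λ ()) λ { (ℓσ ¬sp) → contradiction sp ¬sp ; (ℓκ _) → refl }

  σ-up-root : ∀ {v} → Special v → Up (enc (σ v)) root-node
  σ-up-root (v∈ , none) = up-to (λ ()) λ where
    (σσ l)     → contradiction (Largest.below l) (none (trans (Largest.holds l) v∈))
    (σκ refl _) → cong κ v∈

  root-child : ∀ {b} → Up b root-node → ∃[ v ] Special v × (dec b ≡ σ v ⊎ dec b ≡ ℓ v)
  root-child {b} u = cases refl (subst (λ r → Parent (dec b) r (label b)) (dec-enc (κ ρ)) (up-parent u))
    where
    cases : ∀ {a l} → dec b ≡ a → Parent a (κ ρ) l → ∃[ v ] Special v × (dec b ≡ σ v ⊎ dec b ≡ ℓ v)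
    cases eq (σκ v∈ none) = _ , (v∈ , none) , inj₁ eq
    cases eq (ℓκ sp)      = _ , sp , inj₂ eq
    cases eq (κκ _ l)     = contradiction (Largest.holds l) ρ-parentless

  -- Shows that `σ v` is not a leaf. For special `v` its own leaf hangs at the root; the ascent from
  -- another vertex must then enter the root through `σ v`, because `ℓ v` is childless.
  σ-child : ∀ v → ∃[ b ] Up b (enc (σ v))
  σ-child v with special? v
  ... | no ¬sp = _ , ℓ-up-σ ¬sp
  ... | yes sp with other v
  ...   | x , x≢v with child-towards (⊑-root (enc (ℓ x))) (λ eq → contradiction (enc-injective eq) λ ())
  ...     | b , ℓx⊑b , u with root-child u
  ...       | w , sp′ , which with refl ← special-unique sp sp′ | which
  ...         | inj₁ eq = let c , _ , u′ = child-towards ℓx⊑σ (λ eq → contradiction (enc-injective eq) λ ()) in c , u′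
    where
    ℓx⊑σ : enc (ℓ x) ⊑ enc (σ v)
    ℓx⊑σ = subst (enc (ℓ x) ⊑_) (trans (sym (enc-dec b)) (cong enc eq)) ℓx⊑b
  ...         | inj₂ eq = contradiction (ℓ-injective (enc-injective
      (⊑-ℓ (subst (enc (ℓ x) ⊑_) (trans (sym (enc-dec b)) (cong enc eq)) ℓx⊑b)))) x≢v

  κ-child : ∀ t → ∃[ b ] Up b (enc (κ t))
  κ-child t = let v , v∈ = β-nonempty t
                  b , _ , u = child-towards (below⇒⊴ (t , ε , v∈)) (λ eq → contradiction (enc-injective eq) λ ())
              in b , u

  inner-node : ∀ {a b} → a ≢ κ ρ → Up b (enc a) → ¬ ∣ neighbours (enc a) ∣ ≤ 1
  inner-node {a} a≢ u = two-neighbours (enc a) (inj₁ up) (inj₂ u) λ { refl → up-asym up u }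
    where
    up : Up (enc a) (par (enc a))
    up = a≢ ∘ enc-injective , refl

  root-inner : ¬ ∣ neighbours root-node ∣ ≤ 1
  root-inner with root-child (proj₂ (κ-child ρ))
  ... | v , sp , _ = two-neighbours root-node (inj₂ (ℓ-up-root sp)) (inj₂ (σ-up-root sp))
    λ eq → contradiction (enc-injective eq) λ ()

  leaf⇒ℓ : (l : Leaf graph) → ∃[ v ] proj₁ l ≡ enc (ℓ v)
  leaf⇒ℓ (x , deg≤1) = cases (dec x) (subst (λ y → ∣ neighbours y ∣ ≤ 1) (sym (enc-dec x)) deg≤1) (sym (enc-dec x))
    where
    cases : ∀ a → ∣ neighbours (enc a) ∣ ≤ 1 → x ≡ enc a → ∃[ v ] x ≡ enc (ℓ v)
    cases (ℓ v) _ eq = v , eq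
    cases (σ v) deg≤1 _ = contradiction deg≤1 (inner-node (λ ()) (proj₂ (σ-child v)))
    cases (κ t) deg≤1 _ with t ≟ ρ
    ... | yes refl = contradiction deg≤1 root-inner
    ... | no t≢ = contradiction deg≤1 (inner-node (λ { refl → t≢ refl }) (proj₂ (κ-child t)))

  leaf : V D → Leaf graph
  leaf v = enc (ℓ v) , subsingleton⇒∣S∣≤1 (neighbours (enc (ℓ v)))
    λ y∈ z∈ → same (neighbour⁻ (enc (ℓ v)) y∈) (neighbour⁻ (enc (ℓ v)) z∈)
    where
    same : ∀ {y z} → Up (enc (ℓ v)) y ⊎ Up y (enc (ℓ v)) → Up (enc (ℓ v)) z ⊎ Up z (enc (ℓ v)) → y ≡ z
    same (inj₁ (_ , refl)) (inj₁ (_ , refl)) = refl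
    same (inj₂ u) _ = contradiction u (childless-ℓ {v = v})
    same _ (inj₂ u) = contradiction u (childless-ℓ {v = v})

  vertex : Leaf graph → V D
  vertex l = proj₁ (leaf⇒ℓ l)

  vertex-leaf : ∀ v → vertex (leaf v) ≡ v
  vertex-leaf v = ℓ-injective (enc-injective (sym (proj₂ (leaf⇒ℓ (leaf v)))))

  branchDecomposition : BranchDecomposition D
  branchDecomposition = record
    { tree = graph
    ; undirected = λ {x} {y} → graph-sym {x} {y}
    ; isTree = graph-isTree
    ; subcubic = degree≤3
    ; δ = mk⤖ {to = vertex}
        ( (λ {l} {l′} eq → leaf-≡ {graph} (trans (proj₂ (leaf⇒ℓ l)) (trans (cong (enc ∘ ℓ) eq) (sym (proj₂ (leaf⇒ℓ l′))))))
        , λ v → leaf v , λ { refl → vertex-leaf v })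
    }

  open BranchDecomposition branchDecomposition using (Side; Separates; Thickness)

  private
    Cut : Fin N → Fin N → Rel (Fin N) 0ℓ
    Cut = Minus (Edge graph)

    flip : ∀ {a b x y} → Star (Cut a b) x y → Star (Cut b a) x y
    flip = Star.map (Minus-flip {R = Edge graph})

    back : ∀ {a b x y} → Star (Cut a b) x y → Star (Cut a b) y x
    back = reverse (Minus-sym {R = Edge graph} (λ {x} {y} → graph-sym {x} {y}))

    invariant : ∀ {c u v} → Star (Cut c (par c)) u v → u ⊑ c → v ⊑ c
    invariant = ⊑-invariant (λ {x} {y} → edge⁻ {x} {y})

    sides : ∀ x y z → Star (Cut x y) x z ⊎ Star (Cut x y) y z
    sides = Tree.two-sides (λ {x} {y} → graph-sym {x} {y}) (λ {v} → loopless graph v) graph-isTree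

    side⇒ : ∀ {x y v} → Side x y v → Star (Cut x y) x (enc (ℓ v))
    side⇒ {x} {y} (l , p , refl) = subst (Star (Cut x y) x) (proj₂ (leaf⇒ℓ l)) p

    side⇐ : ∀ {x y v} → Star (Cut x y) x (enc (ℓ v)) → Side x y v
    side⇐ {v = v} p = leaf v , p , vertex-leaf v

  separates : ∀ {x y} → Edge graph x y → ∃[ t ] Separates x y (Γ t)
  separates {x} {y} e with edge⁻ {x} {y} e
  ... | inj₁ (x≢ , refl) = τ (dec x) , λ C in-side out-side →
    let u , u∈ , side  = find in-side
        w , w∈ , ¬side = find out-side
    in Γ-separates x≢ C u∈ w∈ (invariant (side⇒ side) ε) λ w⊑x →
      [ ¬side ∘ side⇐ , (λ p → par⋢ x≢ (invariant (back p) w⊑x)) ]′ (sides x (par x) (enc (ℓ w)))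
  -- The part below `y` is now the opposite side, so `u` and `w` exchange roles.
  ... | inj₂ (y≢ , refl) = τ (dec y) , λ C in-side out-side →
    let u , u∈ , side  = find in-side
        w , w∈ , ¬side = find out-side
    in Γ-separates y≢ C w∈ u∈
      ([ (λ p → contradiction (side⇐ p) ¬side) , (λ p → invariant (flip p) ε) ]′ (sides (par y) y (enc (ℓ w))))
      λ u⊑y → par⋢ y≢ (invariant (back (flip (side⇒ side))) u⊑y)

  thickness≤ : ∀ {x y j} → Edge graph x y → Thickness x y j → j ≤ suc width
  thickness≤ e (_ , least) = let t , sep = separates e in ≤-trans (least (Γ t , sep , refl)) (∣Γ∣≤ 𝒯 t)

-- Combination of the two bounds.

tree⇒branch : {D : Digraph} (𝒯 : TreeDecomposition D) → ¬ order D ≤ 1 →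
  ¬ ¬ (∃[ j ] (Σ (BranchDecomposition D) λ ℬ → BranchDecomposition.Width ℬ j) ×
              j ≤ suc (TreeDecomposition.width 𝒯))
tree⇒branch {D} 𝒯 large ¬ℬ =
  fin-¬¬ (λ t → fin-¬¬ λ t′ → ¬¬-excluded-middle {A = Walk (TreeDecomposition.tree 𝒯) t t′}) λ walk? →
  let open BranchFromTree 𝒯 walk? other
      bound : ∀ {j} → j ≡ 0 ⊎ (∃[ x ] ∃[ y ] Edge graph x y × BranchDecomposition.Thickness branchDecomposition x y j) →
              j ≤ suc (TreeDecomposition.width 𝒯)
      bound = λ { (inj₁ refl) → z≤n ; (inj₂ (x , y , e , thick)) → thickness≤ {x} {y} e thick }
  in greatest-¬¬ _ (0 , inj₁ refl) bound λ (j , w) → ¬ℬ (j , (branchDecomposition , w) , bound (proj₁ w))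
  where
  other : ∀ v → ∃[ x ] x ≢ v
  other v = decidable-stable (any? λ x → ¬? (x ≟ v)) λ none → large (≤-trans
    (≤-reflexive (sym (∣⊤∣≡n (order D))))
    (subsingleton⇒∣S∣≤1 ⊤ λ {x} {y} _ _ → trans (only none x) (sym (only none y))))
    where
    only : ¬ (∃[ x ] x ≢ v) → ∀ x → x ≡ v
    only none x = decidable-stable (x ≟ v) λ x≢v → none (x , x≢v)

Width⇒≤order : {D : Digraph} (ℬ : BranchDecomposition D) {k : ℕ} → BranchDecomposition.Width ℬ k → k ≤ order D
Width⇒≤order ℬ (inj₁ refl , _) = z≤n
Width⇒≤order {D} ℬ (inj₂ (_ , _ , _ , _ , least) , _) = ≤-trans
  (least (⊤ , (λ C in-side _ → Any.map (λ _ → ∈⊤) in-side) , refl)) (∣p∣≤n {order D} ⊤)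

theorem3p5 : (D : Digraph) (dbw dtw : ℕ) →
    IsDirectedBranchwidth D dbw → IsDirectedTreewidth D dtw →
    (dbw ∸ 1 ≤ dtw) × (dtw ≤ 9 * dbw + 1)
theorem3p5 D dbw dtw ((ℬ , width-ℬ) , dbw-least) ((𝒯 , refl) , dtw-least) = lower (order D ≤? 1) , upper
  where
  lower : Dec (order D ≤ 1) → dbw ∸ 1 ≤ dtw
  -- The construction needs a second vertex. With only one, `dbw` is at most the order, hence at
  -- most 1, and `dbw ∸ 1` vanishes.
  lower (yes small) = ≤-trans (ℕₚ.∸-monoˡ-≤ 1 (≤-trans (Width⇒≤order ℬ width-ℬ) small)) z≤n
  lower (no large)  = decidable-stable (dbw ∸ 1 ≤? dtw) (¬¬-map
    (λ (j , ℬ′ , j≤) → ℕₚ.∸-monoˡ-≤ 1 (≤-trans (dbw-least ℬ′) j≤)) (tree⇒branch 𝒯 large))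
  upper : dtw ≤ 9 * dbw + 1
  upper = decidable-stable (dtw ≤? 9 * dbw + 1) (¬¬-map
    (λ (𝒯′ , width≤) → ≤-trans (dtw-least (𝒯′ , refl)) width≤) (branch⇒tree ℬ width-ℬ))
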